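{- Let $\Gamma$ be a finite abelian group and let $S\subseteq\Gamma$ with $0\notin S$. Then the mixed Cayley graph $\mathrm{Cay}(\Gamma,S)$ is Eisenstein integral if and only if it is HS-integral.
   Context: $\Gamma$ is written additively. The mixed Cayley graph $\mathrm{Cay}(\Gamma,S)$ has vertex set $\Gamma$ and arc set $\{(a,b): b-a\in S\}$. Its $(0,1)$-adjacency matrix $\mathcal{A}=(a_{uv})$ has $a_{uv}=1$ if $(u,v)$ is an arc and $a_{uv}=0$ otherwise. A mixed graph is Eisenstein integral if all eigenvalues of $\mathcal{A}$ are Eisenstein integers, i.e. numbers of the form $a+b\omega_3$ with $a,b\in\mathbb{Z}$ and $\omega_3=\frac{ -1+i\sqrt3}{2}$. The Hermitian adjacency matrix of second kind $\mathcal{H}=(h_{uv})$ is defined by $h_{uv}=1$ if both $(u,v)$ and $(v,u)$ are arcs, $h_{uv}=\frac{1+i\sqrt3}{2}$ if only $(u,v)$ is an arc, $h_{uv}=\frac{1-i\sqrt3}{2}$ if only $(v,u)$ is an arc, and $h_{uv}=0$ otherwise. The graph is HS-integral if all eigenvalues of $\mathcal{H}$ are integers. -}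

module Defs where

open import Level using (Level)
open import Data.Bool using (Bool; true; false)
open import Data.Nat using (ℕ; zero; suc)
open import Data.Integer as ℤ using (ℤ; +_; 0ℤ; 1ℤ)
open import Data.Fin using (Fin; zero; suc; punchIn)
open import Data.List using (List; []; _∷_; map)
open import Data.Vec using (Vec; []; _∷_)
open import Data.Product using (Σ; ∃; _×_; _,_)
open import Relation.Binary.PropositionalEquality using (_≡_)
open import Algebra.Bundles using (AbelianGroup)

-- Eisenstein integers  a + b·ω  with  ω = (-1 + i√3)/2,  ω² = -1 - ω.

record Eis : Set where
  constructor _+_ω
  field
    re : ℤ
    im : ℤ
open Eis public

0E 1E : Eis
0E = 0ℤ + 0ℤ ω
1E = 1ℤ + 0ℤ ω

ℤ→E : ℤ → Eis
ℤ→E n = n + 0ℤ ω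

_+E_ : Eis → Eis → Eis
(a + b ω) +E (c + d ω) = (a ℤ.+ c) + (b ℤ.+ d) ω

-E_ : Eis → Eis
-E (a + b ω) = (ℤ.- a) + (ℤ.- b) ω

_*E_ : Eis → Eis → Eis
(a + b ω) *E (c + d ω) =
  (a ℤ.* c ℤ.- b ℤ.* d) + (a ℤ.* d ℤ.+ b ℤ.* c ℤ.- b ℤ.* d) ω

-- Polynomials over ℤ[ω] as coefficient lists (constant term first).

Poly : Set
Poly = List Eis

coeff : ℕ → Poly → Eis
coeff _       []       = 0E
coeff zero    (a ∷ _)  = a
coeff (suc k) (_ ∷ p)  = coeff k p

-- equality of polynomials: all coefficients agree (trailing zeros ignored)
_≈ₚ_ : Poly → Poly → Set
p ≈ₚ q = ∀ k → coeff k p ≡ coeff k q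

_+ₚ_ : Poly → Poly → Poly
[]      +ₚ q       = q
p       +ₚ []      = p
(a ∷ p) +ₚ (b ∷ q) = (a +E b) ∷ (p +ₚ q)

-ₚ_ : Poly → Poly
-ₚ p = map -E_ p

_-ₚ_ : Poly → Poly → Poly
p -ₚ q = p +ₚ (-ₚ q)

scaleₚ : Eis → Poly → Poly
scaleₚ a q = map (a *E_) q

_*ₚ_ : Poly → Poly → Poly
[]      *ₚ q = []
(a ∷ p) *ₚ q = scaleₚ a q +ₚ (0E ∷ (p *ₚ q))

constₚ : Eis → Poly
constₚ a = a ∷ []

oneₚ : Poly
oneₚ = constₚ 1E

Xₚ : Poly
Xₚ = 0E ∷ 1E ∷ []

altSum : ∀ {m} → (Fin m → Poly) → Poly
altSum {zero}  f = []
altSum {suc m} f = f zero -ₚ altSum (λ j → f (suc j))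

det : ∀ n → (Fin n → Fin n → Poly) → Poly
det zero    M = oneₚ
det (suc n) M =
  altSum (λ j → M zero j *ₚ det n (λ i k → M (suc i) (punchIn j k)))

Matrix : ℕ → Set
Matrix n = Fin n → Fin n → Eis

δ : ∀ {n} → Fin n → Fin n → Eis
δ zero    zero    = 1E
δ zero    (suc _) = 0E
δ (suc _) zero    = 0E
δ (suc i) (suc j) = δ i j

charPoly : ∀ n → Matrix n → Poly
charPoly n M = det n (λ i j → (constₚ (δ i j) *ₚ Xₚ) -ₚ constₚ (M i j))

linProd : ∀ {n} → Vec Eis n → Poly
linProd []       = oneₚ
linProd (l ∷ ls) = (Xₚ -ₚ constₚ l) *ₚ linProd ls

-- all eigenvalues (roots of the characteristic polynomial, with
-- multiplicity) are Eisenstein integers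
AllEigenvaluesEisenstein : ∀ n → Matrix n → Set
AllEigenvaluesEisenstein n M =
  Σ (Vec Eis n) λ ls → charPoly n M ≈ₚ linProd ls

AllEigenvaluesIntegers : ∀ n → Matrix n → Set
AllEigenvaluesIntegers n M =
  Σ (Vec ℤ n) λ ls → charPoly n M ≈ₚ linProd (Data.Vec.map ℤ→E ls)

module _ {c ℓ : Level} (G : AbelianGroup c ℓ) where
  open AbelianGroup G

  record Enumeration (n : ℕ) : Set (c Level.⊔ ℓ) where
    field
      elem      : Fin n → Carrier
      injective : ∀ i j → elem i ≈ elem j → i ≡ j
      surjective : ∀ x → ∃ λ i → elem i ≈ x

  RespectsEq : (Carrier → Bool) → Set (c Level.⊔ ℓ)
  RespectsEq S = ∀ {x y} → x ≈ y → S x ≡ S y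

  module _ {n : ℕ} (E : Enumeration n) (S : Carrier → Bool) where
    open Enumeration E

    arc : Fin n → Fin n → Bool
    arc u v = S (elem v ∙ elem u ⁻¹)

    adjMatrix : Matrix n
    adjMatrix u v with arc u v
    ... | true  = 1E
    ... | false = 0E

    -- Hermitian adjacency matrix of the second kind:
    --   1 (both arcs),  (1+i√3)/2 = 1 + ω (only (u,v)),
    --   (1-i√3)/2 = -ω (only (v,u)),  0 otherwise
    hermMatrix₂ : Matrix n
    hermMatrix₂ u v with arc u v | arc v u
    ... | true  | true  = 1E
    ... | true  | false = 1ℤ + 1ℤ ω
    ... | false | true  = 0ℤ + ℤ.-[1+ 0 ] ω
    ... | false | false = 0E

    EisensteinIntegral : Set
    EisensteinIntegral = AllEigenvaluesEisenstein n adjMatrix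

    HSIntegral : Set
    HSIntegral = AllEigenvaluesIntegers n hermMatrix₂

{-# OPTIONS --safe #-}

-- Let A be the adjacency matrix and H the Hermitian one, ω = ω₃ and π = 1 − ω.  Then
-- H = (1 + ω) A − ω Aᵀ and π A = Hᵀ − ω H, so each of H and π A is a combination aM + bMᵀ of
-- commuting matrices M, Mᵀ (w ↦ u + v − w exchanges the two sides of normality).  If the
-- characteristic polynomial of M is ∏ (X − μᵢ), then ∏ (M − μᵢ) = 0 by Cayley–Hamilton, and
-- expanding gives ∏ᵢⱼ (C − aμᵢ − bμⱼ) = 0 for C = aM + bMᵀ.  A factor C − c injective on
-- ℤ[ω]ⁿ can be cancelled.  For C = H this removes every non-real c, because H is
-- Hermitian; for C = π A it removes every c not divisible by π, because
-- (π A − c) v = 0 then makes v divisible by all powers of π.  Conversely, if p = ∏ (X − c)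
-- kills C, then p·I = (X − C) Q for a polynomial matrix Q, so the characteristic polynomial of
-- C divides pⁿ, and being monic it splits into linear factors of p.
module Submission where

open import Level using (Level; 0ℓ)
open import Data.Nat as ℕ using (ℕ; zero; suc; z≤n; s≤s)
import Data.Nat.Properties as ℕₚ
open import Data.Bool using (Bool; true; false)
open import Data.Fin using (Fin; zero; suc; punchIn)
open import Data.Fin.Properties using (suc-injective; _≟_)
open import Data.Fin.Permutation using (Permutation′; permutation)
import Data.Integer as Int
open Int using (ℤ; 0ℤ; 1ℤ)
import Data.Integer.Properties as ℤₚ
import Data.Integer.DivMod as ℤ-DivMod
open import Data.Integer.Tactic.RingSolver using (solve-∀)
open import Data.Maybe using (just; nothing)
open import Data.Unit using (⊤; tt)
open import Data.Empty using (⊥-elim)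
open import Data.Product using (Σ; ∃; _×_; _,_; proj₁; proj₂)
open import Data.Sum as Sum using (_⊎_; inj₁; inj₂)
open import Relation.Nullary using (¬_; Dec; yes; no)
open import Relation.Binary.PropositionalEquality as ≡ using (_≡_; _≢_; _≗_)
import Relation.Binary.Reasoning.Setoid as ≈-Reasoning
open import Algebra.Bundles using (CommutativeRing; AbelianGroup)
import Algebra.Properties.Ring
import Algebra.Properties.AbelianGroup
import Algebra.Properties.CommutativeSemigroup
import Algebra.Properties.Semiring.Sum
open import Tactic.RingSolver.Core.AlmostCommutativeRing using (AlmostCommutativeRing; fromCommutativeRing)
import Tactic.RingSolver
open import Function using (_∘_)
open import Function.Bundles using (_⇔_; mk⇔)

-- The usual route diagonalises both matrices by the characters of the group, whose values in
-- general lie outside ℤ[ω]. Here nothing leaves ℤ[ω]: an eigenvalue condition is a factorisation of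
-- a characteristic polynomial, and eigenvectors give way to products of factors M - c that
-- annihilate every vector. The price is that such products only list candidates: it is not known
-- which eigenvalue of M goes with which eigenvalue of its transpose, so every sum aμᵢ + bμⱼ occurs
-- and the spurious ones must be removed. The two directions differ because the passage from (A, Aᵀ)
-- to (H, Hᵀ) has determinant (1 + ω)² - ω² = 1 + 2ω = ωπ, which is not a unit. Integer eigenvalues
-- of H therefore give the eigenvalues of A a priori with a denominator π. The divisibility argument
-- that removes it is an elementary substitute for the fact that ℤ[ω] is integrally closed.

-- Deleting two columns leaves the same columns in either order: `b` is the position of `a′` once
-- `a` is gone, and `b′` that of `a` once `a′` is gone.
punchIn-punchIn : ∀ {n} (a : Fin (suc (suc n))) (b : Fin (suc n)) (a′ : Fin (suc (suc n))) (b′ : Fin (suc n)) →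
  punchIn a b ≡ a′ → punchIn a′ b′ ≡ a →
  ∀ i → punchIn a (punchIn b i) ≡ punchIn a′ (punchIn b′ i)
punchIn-punchIn zero b .(suc b) zero ≡.refl q i = ≡.refl
punchIn-punchIn zero b .(suc b) (suc b′) ≡.refl () i
punchIn-punchIn (suc a) zero .zero .a ≡.refl ≡.refl i = ≡.refl
punchIn-punchIn (suc a) (suc b) .(suc (punchIn a b)) zero ≡.refl () i
punchIn-punchIn (suc a) (suc b) .(suc (punchIn a b)) (suc b′) ≡.refl q zero = ≡.refl
punchIn-punchIn (suc a) (suc b) .(suc (punchIn a b)) (suc b′) ≡.refl q (suc i) =
  ≡.cong suc (punchIn-punchIn a b _ b′ ≡.refl (suc-injective q) i)

-- Determinants and alternating forms over a commutative ring

module Determinant {c ℓ} (R : CommutativeRing c ℓ) where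
  open import Data.Vec.Functional using (_∷_; insertAt)
  open CommutativeRing R hiding (zero)
  open Algebra.Properties.Ring ring
  open Algebra.Properties.Semiring.Sum semiring
  open ≈-Reasoning setoid
  open Algebra.Properties.CommutativeSemigroup +-commutativeSemigroup using () renaming (interchange to +-interchange)
  open Algebra.Properties.CommutativeSemigroup *-commutativeSemigroup using () renaming (x∙yz≈y∙xz to *-left-comm)

  Row : ℕ → Set c
  Row m = Fin m → Carrier

  Rows : ℕ → ℕ → Set c
  Rows n m = Fin n → Row m

  infix 4 _≐_
  _≐_ : ∀ {m} → Row m → Row m → Set ℓ
  x ≐ y = ∀ k → x k ≈ y k

  unit : ∀ {n} → Fin n → Fin n → Carrier
  unit zero    zero    = 1#
  unit zero    (suc _) = 0#
  unit (suc _) zero    = 0#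
  unit (suc i) (suc j) = unit i j

  altSum : ∀ {m} → (Fin m → Carrier) → Carrier
  altSum {zero}  f = 0#
  altSum {suc m} f = f zero - altSum (f ∘ suc)

  minor : ∀ {n} → Rows (suc n) (suc n) → Fin (suc n) → Rows n n
  minor M j i k = M (suc i) (punchIn j k)

  -- Mirrors the recursion in the definition of the characteristic polynomial, over any ring; `det≋`
  -- passes between the two.
  det : ∀ n → Rows n n → Carrier
  det zero    M = 1#
  det (suc n) M = altSum (λ j → M zero j * det n (minor M j))

  altSum-cong : ∀ {m} {f g : Row m} → f ≐ g → altSum f ≈ altSum g
  altSum-cong {zero}  e = refl
  altSum-cong {suc m} e = +-cong (e zero) (-‿cong (altSum-cong (e ∘ suc)))

  sgn : ∀ {n} → Fin n → Carrier
  sgn zero    = 1#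
  sgn (suc j) = - sgn j

  sgn*sgn : ∀ {n} (j : Fin n) → sgn j * sgn j ≈ 1#
  sgn*sgn zero    = *-identityˡ 1#
  sgn*sgn (suc j) = begin
    - sgn j * - sgn j     ≈⟨ -‿distribˡ-* _ _ ⟨
    - (sgn j * - sgn j)   ≈⟨ -‿cong (-‿distribʳ-* _ _) ⟨
    - - (sgn j * sgn j)   ≈⟨ -‿involutive _ ⟩
    sgn j * sgn j         ≈⟨ sgn*sgn j ⟩
    1#                    ∎

  sum-neg : ∀ {m} (f : Row m) → sum (λ i → - f i) ≈ - sum f
  sum-neg {zero}  f = sym -0#≈0#
  sum-neg {suc m} f = trans (+-congˡ (sum-neg (f ∘ suc))) (-‿+-comm _ _)

  altSum≈sum : ∀ {m} (f : Row m) → altSum f ≈ sum (λ j → sgn j * f j)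
  altSum≈sum {zero}  f = refl
  altSum≈sum {suc m} f = +-cong (sym (*-identityˡ _)) (begin
    - altSum (f ∘ suc)                    ≈⟨ -‿cong (altSum≈sum (f ∘ suc)) ⟩
    - sum (λ j → sgn j * f (suc j))       ≈⟨ sum-neg (λ j → sgn j * f (suc j)) ⟨
    sum (λ j → - (sgn j * f (suc j)))     ≈⟨ sum-cong-≋ {m} (λ j → -‿distribˡ-* _ _) ⟩
    sum (λ j → - sgn j * f (suc j))       ∎)

  altSum-linear : ∀ {m} a {h f g : Row m} → (∀ j → h j ≈ a * f j + g j) → altSum h ≈ a * altSum f + altSum g
  altSum-linear {zero}  a e = sym (trans (+-identityʳ _) (zeroʳ a))
  altSum-linear {suc m} a {h} {f} {g} e = begin
    h zero - altSum (h ∘ suc)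
      ≈⟨ +-cong (e zero) (-‿cong (altSum-linear a (e ∘ suc))) ⟩
    (a * f zero + g zero) - (a * F + G)
      ≈⟨ +-congˡ (sym (-‿+-comm _ _)) ⟩
    (a * f zero + g zero) + (- (a * F) - G)
      ≈⟨ +-interchange _ _ _ _ ⟩
    (a * f zero - a * F) + (g zero - G)
      ≈⟨ +-congʳ (+-congˡ (-‿distribʳ-* _ _)) ⟩
    (a * f zero + a * - F) + (g zero - G)
      ≈⟨ +-congʳ (distribˡ a _ _) ⟨
    a * (f zero - F) + (g zero - G) ∎
    where
    F = altSum (f ∘ suc)
    G = altSum (g ∘ suc)

  altSum-zero : ∀ {m} {f : Row m} → (∀ j → f j ≈ 0#) → altSum f ≈ 0#
  altSum-zero {zero}  e = refl
  altSum-zero {suc m} e = trans (+-cong (e zero) (-‿cong (altSum-zero (e ∘ suc)))) (-‿inverseʳ 0#)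

  -- φ j k is a term attached to the pair of columns j and punchIn j k;
  -- each unordered pair occurs twice, with opposite signs.
  altSum-symmetric : ∀ m (φ : Fin (suc m) → Fin m → Carrier) →
    (∀ j k j′ k′ → punchIn j k ≡ j′ → punchIn j′ k′ ≡ j → φ j k ≈ φ j′ k′) →
    altSum (λ j → altSum (φ j)) ≈ 0#
  altSum-symmetric zero    φ s = -‿inverseʳ 0#
  altSum-symmetric (suc m) φ s = begin
    -- The pairs containing column zero occur once as A and once as the terms `φ (suc j) zero`;
    -- these cancel, and the remaining pairs form the same sum with one column fewer.
    A - altSum (λ j → altSum (φ (suc j)))
      ≈⟨ +-congˡ (-‿cong (altSum-linear {suc m} 1# {f = λ j → φ (suc j) zero} {λ j → - altSum (λ k → φ (suc j) (suc k))} (λ j → +-congʳ (sym (*-identityˡ _))))) ⟩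
    A - (1# * altSum (λ j → φ (suc j) zero) + altSum (λ j → - altSum (λ k → φ (suc j) (suc k))))
      ≈⟨ +-congˡ (-‿cong (+-cong (trans (*-identityˡ _) (altSum-cong (λ k → sym (s zero k (suc k) zero ≡.refl ≡.refl))))
           (altSum-linear {suc m} (- 1#) {f = λ j → altSum (λ k → φ (suc j) (suc k))} (λ j → trans (sym (-1*x≈-x _)) (sym (+-identityʳ _)))))) ⟩
    A - (A + (- 1# * altSum (λ j → altSum (λ k → φ (suc j) (suc k))) + altSum (λ (j : Fin (suc m)) → 0#)))
      ≈⟨ +-congˡ (-‿cong (+-congˡ (+-cong (*-congˡ (altSum-symmetric m _ s′)) (altSum-zero {suc m} (λ _ → refl))))) ⟩
    A - (A + (- 1# * 0# + 0#))
      ≈⟨ +-congˡ (-‿cong (+-congˡ (trans (+-identityʳ _) (zeroʳ _)))) ⟩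
    A - (A + 0#)
      ≈⟨ +-congˡ (-‿cong (+-identityʳ _)) ⟩
    A - A
      ≈⟨ -‿inverseʳ A ⟩
    0# ∎
    where
    A = altSum (φ zero)
    s′ : ∀ j k j′ k′ → punchIn j k ≡ j′ → punchIn j′ k′ ≡ j → φ (suc j) (suc k) ≈ φ (suc j′) (suc k′)
    s′ j k j′ k′ p q = s (suc j) (suc k) (suc j′) (suc k′) (≡.cong suc p) (≡.cong suc q)

  -- Comparing three matrices that agree off row `i` avoids row updates, and one clause covers both
  -- additivity and scaling.
  record Multilinear {n m} (F : Rows n m → Carrier) : Set (c Level.⊔ ℓ) where
    field
      cong   : ∀ {M N} → (∀ i → M i ≐ N i) → F M ≈ F N
      linear : ∀ i a {M P Q} → (∀ k → M i k ≈ a * P i k + Q i k) →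
               (∀ h → h ≢ i → M h ≐ P h) → (∀ h → h ≢ i → M h ≐ Q h) →
               F M ≈ a * F P + F Q

  -- Vanishing on equal rows, rather than a change of sign under swaps, is the right condition in a
  -- ring where 2 may be a zero divisor.
  record Alternating {n m} (F : Rows n m → Carrier) : Set (c Level.⊔ ℓ) where
    field
      multilinear : Multilinear F
      vanish      : ∀ i j M → i ≢ j → M i ≐ M j → F M ≈ 0#
    open Multilinear multilinear public

  ∷-cong : ∀ {n m} {x y : Row m} {M N : Rows n m} → x ≐ y → (∀ i → M i ≐ N i) → ∀ i → (x ∷ M) i ≐ (y ∷ N) i
  ∷-cong e f zero    = e
  ∷-cong e f (suc i) = f i

  ∷-other : ∀ {n m} {x y : Row m} {M : Rows n m} h → h ≢ zero → (x ∷ M) h ≐ (y ∷ M) h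
  ∷-other zero    p   = ⊥-elim (p ≡.refl)
  ∷-other (suc h) p k = refl

  ∷-η : ∀ {n m} (M : Rows (suc n) m) i → M i ≐ (M zero ∷ (M ∘ suc)) i
  ∷-η M zero    k = refl
  ∷-η M (suc i) k = refl

  multilinear-tail : ∀ {n m} {F : Rows (suc n) m → Carrier} → Multilinear F → ∀ x → Multilinear (λ M → F (x ∷ M))
  multilinear-tail lin x = record
    { cong   = λ e → cong (∷-cong (λ _ → refl) e)
    ; linear = λ i a {M} {P} {Q} e p q → linear (suc i) a {x ∷ M} {x ∷ P} {x ∷ Q} e
        (λ { zero _ k → refl ; (suc h) r → p h (r ∘ ≡.cong suc) })
        (λ { zero _ k → refl ; (suc h) r → q h (r ∘ ≡.cong suc) })
    }
    where open Multilinear lin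

  alternating-tail : ∀ {n m} {F : Rows (suc n) m → Carrier} → Alternating F → ∀ x → Alternating (λ M → F (x ∷ M))
  alternating-tail alt x = record
    { multilinear = multilinear-tail multilinear x
    ; vanish      = λ i j M i≢j e → vanish (suc i) (suc j) (x ∷ M) (i≢j ∘ suc-injective) e
    }
    where open Alternating alt

  linear-head : ∀ {n m} {F : Rows (suc n) m → Carrier} → Multilinear F →
                ∀ a {x y z : Row m} (M : Rows n m) → (∀ k → x k ≈ a * y k + z k) →
                F (x ∷ M) ≈ a * F (y ∷ M) + F (z ∷ M)
  linear-head lin a M e = Multilinear.linear lin zero a e ∷-other ∷-other

  module _ {n m} {F : Rows (suc (suc n)) m → Carrier} (alt : Alternating F) where
    open Alternating alt

    -- Polarisation: expand the vanishing value at two equal rows x + y; the two diagonal terms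
    -- vanish as well.
    swap-heads : ∀ x y (M : Rows n m) → F (x ∷ y ∷ M) ≈ - F (y ∷ x ∷ M)
    swap-heads x y M = +-inverseˡ-unique _ _ (begin
      F (x ∷ y ∷ M) + F (y ∷ x ∷ M)
        ≈⟨ +-cong (sym (+-identityˡ _)) (sym (+-identityʳ _)) ⟩
      (0# + F (x ∷ y ∷ M)) + (F (y ∷ x ∷ M) + 0#)
        ≈⟨ +-cong (+-congʳ (sym (diag x))) (+-congˡ (sym (diag y))) ⟩
      (F (x ∷ x ∷ M) + F (x ∷ y ∷ M)) + (F (y ∷ x ∷ M) + F (y ∷ y ∷ M))
        ≈⟨ +-cong (sym (second x)) (sym (second y)) ⟩
      F (x ∷ x+y ∷ M) + F (y ∷ x+y ∷ M)
        ≈⟨ +-congʳ (sym (*-identityˡ _)) ⟩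
      1# * F (x ∷ x+y ∷ M) + F (y ∷ x+y ∷ M)
        ≈⟨ linear-head multilinear 1# (x+y ∷ M) (λ k → +-congʳ (sym (*-identityˡ _))) ⟨
      F (x+y ∷ x+y ∷ M)
        ≈⟨ diag x+y ⟩
      0# ∎)
      where
      x+y : Row m
      x+y k = x k + y k
      diag : ∀ z → F (z ∷ z ∷ M) ≈ 0#
      diag z = vanish zero (suc zero) _ (λ ()) (λ k → refl)
      second : ∀ z → F (z ∷ x+y ∷ M) ≈ F (z ∷ x ∷ M) + F (z ∷ y ∷ M)
      second z = trans (linear-head (multilinear-tail multilinear z) 1# M (λ k → +-congʳ (sym (*-identityˡ _))))
                       (+-congʳ (*-identityˡ _))

  -- By induction the row reaches the top of the tail; one more swap, costing one sign, carries it
  -- past row zero.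
  move-to-head : ∀ {n m} {F : Rows (suc n) m → Carrier} → Alternating F → ∀ j M →
                 F M ≈ sgn j * F (M j ∷ (M ∘ punchIn j))
  move-to-head alt zero M = trans
    (Alternating.cong alt (∷-η M)) (sym (*-identityˡ _))
  move-to-head {suc n} {F = F} alt (suc j) M = begin
    F M
      ≈⟨ cong (∷-η M) ⟩
    F (M zero ∷ (M ∘ suc))
      ≈⟨ move-to-head (alternating-tail alt (M zero)) j (M ∘ suc) ⟩
    sgn j * F (M zero ∷ M (suc j) ∷ (M ∘ suc ∘ punchIn j))
      ≈⟨ *-congˡ (swap-heads alt _ _ _) ⟩
    sgn j * - F (M (suc j) ∷ M zero ∷ (M ∘ suc ∘ punchIn j))
      ≈⟨ trans (sym (-‿distribʳ-* _ _)) (-‿distribˡ-* _ _) ⟩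
    - sgn j * F (M (suc j) ∷ M zero ∷ (M ∘ suc ∘ punchIn j))
      ≈⟨ *-congˡ (cong (∷-cong (λ _ → refl) (λ { zero k → refl ; (suc i) k → refl }))) ⟩
    - sgn j * F (M (suc j) ∷ (M ∘ punchIn (suc j))) ∎
    where open Alternating alt

  det-cong : ∀ n {M N} → (∀ i → M i ≐ N i) → det n M ≈ det n N
  det-cong zero    e = refl
  det-cong (suc n) e = altSum-cong (λ j → *-cong (e zero j) (det-cong n (λ i k → e (suc i) (punchIn j k))))

  -- Expanding along the first two rows gives a double alternating sum indexed by pairs of deleted
  -- columns. If the rows agree, its terms are symmetric in the two columns, so `altSum-symmetric`
  -- applies.
  det-vanish₀₁ : ∀ n (M : Rows (suc (suc n)) (suc (suc n))) → M zero ≐ M (suc zero) → det (suc (suc n)) M ≈ 0#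
  det-vanish₀₁ n M e = trans (altSum-cong pull) (altSum-symmetric (suc n) φ sym-φ)
    where
    D : Fin (suc (suc n)) → Fin (suc n) → Carrier
    D j k = det n (minor (minor M j) k)
    φ : Fin (suc (suc n)) → Fin (suc n) → Carrier
    φ j k = M zero j * (M (suc zero) (punchIn j k) * D j k)
    pull : ∀ j → M zero j * altSum (λ k → M (suc zero) (punchIn j k) * D j k) ≈ altSum (φ j)
    pull j = sym (trans
      (altSum-linear (M zero j) {f = λ k → M (suc zero) (punchIn j k) * D j k} {λ _ → 0#} (λ k → sym (+-identityʳ _)))
      (trans (+-congˡ (altSum-zero {suc n} (λ _ → refl))) (+-identityʳ _)))
    sym-φ : ∀ j k j′ k′ → punchIn j k ≡ j′ → punchIn j′ k′ ≡ j → φ j k ≈ φ j′ k′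
    sym-φ j k j′ k′ p q = begin
      M zero j * (M (suc zero) (punchIn j k) * D j k)
        ≈⟨ *-left-comm _ _ _ ⟩
      M (suc zero) (punchIn j k) * (M zero j * D j k)
        ≡⟨ ≡.cong₂ (λ a b → M (suc zero) a * (M zero b * D j k)) p (≡.sym q) ⟩
      M (suc zero) j′ * (M zero (punchIn j′ k′) * D j k)
        ≈⟨ *-cong (sym (e j′)) (*-cong (e (punchIn j′ k′)) (det-cong n λ i l →
             reflexive (≡.cong (M (suc (suc i))) (punchIn-punchIn j k j′ k′ p q l)))) ⟩
      M zero j′ * (M (suc zero) (punchIn j′ k′) * D j′ k′) ∎

  -- Alternation in the rows below the first allows the equal row to be moved next to row zero,
  -- which leaves the case of the two top rows.
  det-vanish₀ : ∀ {n} → (∀ x → Alternating (λ M → det (suc n) (x ∷ M))) →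
                ∀ j M → M zero ≐ M (suc j) → det (suc n) M ≈ 0#
  det-vanish₀ {suc n} alt j M e = begin
    det (suc (suc n)) M
      ≈⟨ det-cong (suc (suc n)) (∷-η M) ⟩
    det (suc (suc n)) (M zero ∷ (M ∘ suc))
      ≈⟨ move-to-head (alt (M zero)) j (M ∘ suc) ⟩
    sgn j * det (suc (suc n)) (M zero ∷ M (suc j) ∷ (M ∘ suc ∘ punchIn j))
      ≈⟨ *-congˡ (det-vanish₀₁ n (M zero ∷ M (suc j) ∷ (M ∘ suc ∘ punchIn j)) e) ⟩
    sgn j * 0#
      ≈⟨ zeroʳ _ ⟩
    0# ∎

  det-alternating : ∀ n → Alternating (det n)
  det-alternating zero = record { multilinear = record { cong = λ e → refl ; linear = λ () } ; vanish = λ () }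
  det-alternating (suc n) = record { multilinear = mul ; vanish = van }
    where
    IH = det-alternating n
    lin : ∀ i a {M P Q} → (∀ k → M i k ≈ a * P i k + Q i k) →
          (∀ h → h ≢ i → M h ≐ P h) → (∀ h → h ≢ i → M h ≐ Q h) →
          det (suc n) M ≈ a * det (suc n) P + det (suc n) Q
    lin zero a {M} {P} {Q} e p q = altSum-linear a λ j → begin
      M zero j * det n (minor M j)
        ≈⟨ *-congʳ (e j) ⟩
      (a * P zero j + Q zero j) * det n (minor M j)
        ≈⟨ distribʳ _ _ _ ⟩
      a * P zero j * det n (minor M j) + Q zero j * det n (minor M j)
        ≈⟨ +-cong (trans (*-assoc _ _ _) (*-congˡ (*-congˡ (det-cong n (λ i k → p (suc i) (λ ()) (punchIn j k))))))
                  (*-congˡ (det-cong n (λ i k → q (suc i) (λ ()) (punchIn j k)))) ⟩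
      a * (P zero j * det n (minor P j)) + Q zero j * det n (minor Q j) ∎
    lin (suc i) a {M} {P} {Q} e p q = altSum-linear a λ j → begin
      M zero j * det n (minor M j)
        ≈⟨ *-congˡ (Alternating.linear IH i a (e ∘ punchIn j)
             (λ h r → p (suc h) (r ∘ suc-injective) ∘ punchIn j)
             (λ h r → q (suc h) (r ∘ suc-injective) ∘ punchIn j)) ⟩
      M zero j * (a * det n (minor P j) + det n (minor Q j))
        ≈⟨ distribˡ _ _ _ ⟩
      M zero j * (a * det n (minor P j)) + M zero j * det n (minor Q j)
        ≈⟨ +-cong (trans (*-left-comm _ _ _) (*-congˡ (*-congʳ (p zero (λ ()) j)))) (*-congʳ (q zero (λ ()) j)) ⟩
      a * (P zero j * det n (minor P j)) + Q zero j * det n (minor Q j) ∎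
    mul : Multilinear (det (suc n))
    mul = record { cong = det-cong (suc n) ; linear = lin }
    van-suc : ∀ i j M → i ≢ j → M (suc i) ≐ M (suc j) → det (suc n) M ≈ 0#
    van-suc i j M i≢j e = altSum-zero λ k →
      trans (*-congˡ (Alternating.vanish IH i j (minor M k) i≢j (e ∘ punchIn k))) (zeroʳ (M zero k))
    tail-alternating : ∀ x → Alternating (λ M → det (suc n) (x ∷ M))
    tail-alternating x = record
      { multilinear = multilinear-tail mul x
      ; vanish = λ i j M → van-suc i j (x ∷ M)
      }
    van : ∀ i j M → i ≢ j → M i ≐ M j → det (suc n) M ≈ 0#
    van zero    zero    M p e = ⊥-elim (p ≡.refl)
    van zero    (suc j) M p e = det-vanish₀ tail-alternating j M e
    van (suc i) zero    M p e = det-vanish₀ tail-alternating i M (λ k → sym (e k))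
    van (suc i) (suc j) M p e = van-suc i j M (p ∘ ≡.cong suc) e

  -- Each row is split by linearity in turn, and the part with `v` in that row vanishes.
  -- `det-unique` uses this to clear the column of a unit row.
  shear : ∀ {n m} {F : Rows n m → Carrier} → Multilinear F → (v : Row m) →
          (∀ i M → M i ≐ v → F M ≈ 0#) →
          ∀ (a : Fin n → Carrier) M N → (∀ i k → M i k ≈ a i * v k + N i k) → F M ≈ F N
  shear {zero}  lin v van a M N e = Multilinear.cong lin (λ ())
  shear {suc n} {m} {F} lin v van a M N e = begin
    F M                        ≈⟨ cong (∷-η M) ⟩
    F (M zero ∷ (M ∘ suc))     ≈⟨ linear-head lin (a zero) (M ∘ suc) (e zero) ⟩
    a zero * F (v ∷ (M ∘ suc)) + F (N zero ∷ (M ∘ suc))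
                               ≈⟨ +-congʳ (trans (*-congˡ (van zero (v ∷ (M ∘ suc)) (λ _ → refl))) (zeroʳ _)) ⟩
    0# + F (N zero ∷ (M ∘ suc)) ≈⟨ +-identityˡ _ ⟩
    F (N zero ∷ (M ∘ suc))     ≈⟨ shear (multilinear-tail lin (N zero)) v (λ i P → van (suc i) (N zero ∷ P))
                                    (a ∘ suc) (M ∘ suc) (N ∘ suc) (e ∘ suc) ⟩
    F (N zero ∷ (N ∘ suc))     ≈⟨ cong (∷-η N) ⟨
    F N                        ∎
    where open Multilinear lin

  linear-expansion : ∀ {m} (φ : Row m → Carrier) →
    (∀ {x y} → x ≐ y → φ x ≈ φ y) →
    (∀ a {x y z} → (∀ k → x k ≈ a * y k + z k) → φ x ≈ a * φ y + φ z) →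
    ∀ x → φ x ≈ sum (λ j → x j * φ (unit j))
  linear-expansion {zero} φ cong linear x = begin
    -- In dimension zero x equals -x + x vacuously, so linearity alone yields φ x = -φ x + φ x = 0.
    φ x                          ≈⟨ linear (- 1#) {x} {x} {x} (λ ()) ⟩
    - 1# * φ x + φ x             ≈⟨ +-congʳ (-1*x≈-x _) ⟩
    - φ x + φ x                  ≈⟨ -‿inverseˡ _ ⟩
    0#                           ∎
  linear-expansion {suc m} φ cong linear x = begin
    φ x
      ≈⟨ linear (x zero) {x} {unit zero} {0# ∷ (x ∘ suc)}
           (λ { zero → sym (trans (+-identityʳ _) (*-identityʳ _)) ; (suc k) → sym (trans (+-congʳ (zeroʳ _)) (+-identityˡ _)) }) ⟩
    x zero * φ (unit zero) + φ (0# ∷ (x ∘ suc))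
      ≈⟨ +-congˡ (linear-expansion (λ y → φ (0# ∷ y))
           (λ e → cong (λ { zero → refl ; (suc k) → e k }))
           (λ a e → linear a (λ { zero → sym (trans (+-congʳ (zeroʳ a)) (+-identityˡ _)) ; (suc k) → e k })) (x ∘ suc)) ⟩
    x zero * φ (unit zero) + sum (λ j → x (suc j) * φ (0# ∷ unit j))
      ≈⟨ +-congˡ (sum-cong-≋ {m} λ j → *-congˡ (cong {0# ∷ unit j} {unit (suc j)} (λ { zero → refl ; (suc k) → refl }))) ⟩
    x zero * φ (unit zero) + sum (λ j → x (suc j) * φ (unit (suc j))) ∎

  -- Turns a row of a minor back into a full row, so that a form on full matrices becomes a form on
  -- minors.
  insert₀ : ∀ {n} → Fin (suc n) → Row n → Row (suc n)
  insert₀ j r = insertAt r j 0#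

  insert₀-cong : ∀ {n} (j : Fin (suc n)) {x y : Row n} → x ≐ y → insert₀ j x ≐ insert₀ j y
  insert₀-cong zero e zero = refl
  insert₀-cong zero e (suc k) = e k
  insert₀-cong {suc n} (suc j) e zero = e zero
  insert₀-cong {suc n} (suc j) e (suc k) = insert₀-cong j (e ∘ suc) k

  insert₀-linear : ∀ {n} (j : Fin (suc n)) a {x y z : Row n} → (∀ k → x k ≈ a * y k + z k) →
                   ∀ k → insert₀ j x k ≈ a * insert₀ j y k + insert₀ j z k
  insert₀-linear zero a e zero = sym (trans (+-identityʳ _) (zeroʳ a))
  insert₀-linear zero a e (suc k) = e k
  insert₀-linear {suc n} (suc j) a e zero = e zero
  insert₀-linear {suc n} (suc j) a e (suc k) = insert₀-linear j a (e ∘ suc) k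

  insert₀-unit : ∀ {n} (j : Fin (suc n)) i → insert₀ j (unit i) ≐ unit (punchIn j i)
  insert₀-unit zero i zero = refl
  insert₀-unit zero i (suc k) = refl
  insert₀-unit {suc n} (suc j) zero zero = refl
  insert₀-unit {suc n} (suc j) (suc i) zero = refl
  insert₀-unit {suc n} (suc j) zero (suc k) = lemma j k
    where
    lemma : ∀ {n} (j : Fin (suc n)) k → insert₀ j (λ _ → 0#) k ≈ 0#
    lemma zero zero = refl
    lemma zero (suc k) = refl
    lemma {suc n} (suc j) zero = refl
    lemma {suc n} (suc j) (suc k) = lemma j k
  insert₀-unit {suc n} (suc j) (suc i) (suc k) = insert₀-unit j i k

  split-entry : ∀ {n} (j : Fin (suc n)) (r : Row (suc n)) k →
                r k ≈ r j * unit j k + insert₀ j (r ∘ punchIn j) k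
  split-entry zero r zero = sym (trans (+-identityʳ _) (*-identityʳ _))
  split-entry zero r (suc k) = sym (trans (+-congʳ (zeroʳ _)) (+-identityˡ _))
  split-entry {suc n} (suc j) r zero = sym (trans (+-congʳ (zeroʳ _)) (+-identityˡ _))
  split-entry {suc n} (suc j) r (suc k) = split-entry j (r ∘ suc) k

  -- After expansion of the first row, term j has top row `unit j`, so column j can be cleared
  -- elsewhere. What is left is an alternating form of the minor, known by induction up to its value
  -- at the identity; the sign comes from moving row j of the identity to the top.
  det-unique : ∀ n {F : Rows n n → Carrier} → Alternating F → ∀ M → F M ≈ det n M * F unit
  det-unique zero alt M = trans (Alternating.cong alt (λ ())) (sym (*-identityˡ _))
  det-unique (suc n) {F} alt M = begin
    F M
      ≈⟨ cong (∷-η M) ⟩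
    F (M zero ∷ (M ∘ suc))
      ≈⟨ linear-expansion (λ x → F (x ∷ (M ∘ suc))) (λ e → cong (∷-cong e (λ _ _ → refl)))
           (λ a e → linear-head multilinear a (M ∘ suc) e) (M zero) ⟩
    sum (λ j → M zero j * F (unit j ∷ (M ∘ suc)))
      ≈⟨ sum-cong-≋ {suc n} (λ j → *-congˡ {M zero j} (term j)) ⟩
    sum (λ j → M zero j * (det n (minor M j) * (sgn j * F unit)))
      ≈⟨ sum-cong-≋ regroup ⟩
    sum (λ j → sgn j * (M zero j * det n (minor M j)) * F unit)
      ≈⟨ *-distribʳ-sum (F unit) (λ j → sgn j * (M zero j * det n (minor M j))) ⟨
    sum (λ j → sgn j * (M zero j * det n (minor M j))) * F unit
      ≈⟨ *-congʳ (altSum≈sum (λ j → M zero j * det n (minor M j))) ⟨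
    det (suc n) M * F unit ∎
    where
    open Alternating alt
    G : Fin (suc n) → Rows n n → Carrier
    G j P = F (unit j ∷ (insert₀ j ∘ P))
    G-alternating : ∀ j → Alternating (G j)
    G-alternating j = record
      { multilinear = record
        { cong   = λ e → A.cong (λ i → insert₀-cong j (e i))
        ; linear = λ i a e p q → A.linear i a (insert₀-linear j a e)
                     (λ h r → insert₀-cong j (p h r)) (λ h r → insert₀-cong j (q h r))
        }
      ; vanish = λ i k P i≢k e → A.vanish i k (insert₀ j ∘ P) i≢k (insert₀-cong j e)
      }
      where module A = Alternating (alternating-tail alt (unit j))
    G-unit : ∀ j → G j unit ≈ sgn j * F unit
    G-unit j = begin
      F (unit j ∷ (insert₀ j ∘ unit))             ≈⟨ cong (∷-cong (λ _ → refl) (insert₀-unit j)) ⟩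
      F (unit j ∷ (unit ∘ punchIn j))             ≈⟨ *-identityˡ _ ⟨
      1# * F (unit j ∷ (unit ∘ punchIn j))        ≈⟨ *-congʳ (sgn*sgn j) ⟨
      sgn j * sgn j * F (unit j ∷ (unit ∘ punchIn j)) ≈⟨ *-assoc _ _ _ ⟩
      sgn j * (sgn j * F (unit j ∷ (unit ∘ punchIn j))) ≈⟨ *-congˡ (move-to-head alt j unit) ⟨
      sgn j * F unit ∎
    term : ∀ j → F (unit j ∷ (M ∘ suc)) ≈ det n (minor M j) * (sgn j * F unit)
    term j = begin
      F (unit j ∷ (M ∘ suc))
        ≈⟨ shear (multilinear-tail multilinear (unit j)) (unit j)
             (λ i P e → vanish zero (suc i) (unit j ∷ P) (λ ()) (λ k → sym (e k)))
             (λ i → M (suc i) j) (M ∘ suc) (insert₀ j ∘ minor M j) (λ i → split-entry j (M (suc i))) ⟩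
      G j (minor M j)                     ≈⟨ det-unique n (G-alternating j) (minor M j) ⟩
      det n (minor M j) * G j unit        ≈⟨ *-congˡ (G-unit j) ⟩
      det n (minor M j) * (sgn j * F unit) ∎
    regroup : ∀ j → M zero j * (det n (minor M j) * (sgn j * F unit)) ≈ sgn j * (M zero j * det n (minor M j)) * F unit
    regroup j = begin
      M zero j * (det n (minor M j) * (sgn j * F unit)) ≈⟨ *-assoc _ _ _ ⟨
      M zero j * det n (minor M j) * (sgn j * F unit)   ≈⟨ *-left-comm _ _ _ ⟩
      sgn j * (M zero j * det n (minor M j) * F unit)   ≈⟨ *-assoc _ _ _ ⟨
      sgn j * (M zero j * det n (minor M j)) * F unit   ∎

  -- Matrix products and the adjugate

  infixl 7 _·_
  _·_ : ∀ {n m l} → Rows n m → Rows m l → Rows n l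
  (M · N) i k = sum (λ j → M i j * N j k)

  sum-linear : ∀ {m} a {f g h : Row m} → (∀ k → f k ≈ a * g k + h k) → sum f ≈ a * sum g + sum h
  sum-linear a {f} {g} {h} e = begin
    sum f                           ≈⟨ sum-cong-≋ e ⟩
    sum (λ k → a * g k + h k)       ≈⟨ ∑-distrib-+ (λ k → a * g k) h ⟩
    sum (λ k → a * g k) + sum h     ≈⟨ +-congʳ (*-distribˡ-sum a g) ⟨
    a * sum g + sum h               ∎

  sum-unitˡ : ∀ {m} (i : Fin m) (f : Row m) → sum (λ j → unit i j * f j) ≈ f i
  sum-unitˡ {suc m} zero f = trans (+-cong (*-identityˡ _)
    (trans (sum-cong-≋ (λ j → zeroˡ (f (suc j)))) (sum-replicate-zero m))) (+-identityʳ _)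
  sum-unitˡ (suc i) f = trans (+-cong (zeroˡ _) (sum-unitˡ i (f ∘ suc))) (+-identityˡ _)

  det-scalar-suc : ∀ n p → det (suc n) (λ i k → p * unit i k) ≈ p * det n (λ i k → p * unit i k)
  det-scalar-suc n p = begin
    p * 1# * D - altSum {n} (λ j → p * 0# * _)
      ≈⟨ +-cong (*-congʳ (*-identityʳ p)) (-‿cong (altSum-zero {n} (λ j → trans (*-congʳ (zeroʳ p)) (zeroˡ _)))) ⟩
    p * D - 0#  ≈⟨ +-congˡ -0#≈0# ⟩
    p * D + 0#  ≈⟨ +-identityʳ _ ⟩
    p * D       ∎
    where D = det n (λ i k → p * unit i k)

  -- For fixed N, the map P ↦ det (P · N) is alternating in the rows of P and takes the value det N
  -- at the identity, so uniqueness decides.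
  det-· : ∀ n (M N : Rows n n) → det n (M · N) ≈ det n M * det n N
  det-· n M N = trans (det-unique n {λ P → det n (P · N)} alt M)
    (*-congˡ (det-cong n (λ i k → sum-unitˡ i (λ j → N j k))))
    where
    module D = Alternating (det-alternating n)
    ·-congˡ : ∀ {x y : Row n} → x ≐ y → ∀ k → sum (λ j → x j * N j k) ≈ sum (λ j → y j * N j k)
    ·-congˡ e k = sum-cong-≋ (λ j → *-congʳ (e j))
    alt : Alternating (λ P → det n (P · N))
    alt = record
      { multilinear = record
        { cong   = λ e → D.cong (λ i → ·-congˡ (e i))
        ; linear = λ i a {M = L} {P} {Q} e p q → D.linear i a {L · N} {P · N} {Q · N}
            (λ k → sum-linear a (λ j → trans (*-congʳ (e j)) (trans (distribʳ _ _ _) (+-congʳ (*-assoc _ _ _)))))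
            (λ h r → ·-congˡ (p h r)) (λ h r → ·-congˡ (q h r))
        }
      ; vanish = λ i j P i≢j e → D.vanish i j (P · N) i≢j (·-congˡ e)
      }

  replaceRow : ∀ {n m} → Fin n → Row m → Rows n m → Rows n m
  replaceRow zero    x M zero    = x
  replaceRow zero    x M (suc h) = M (suc h)
  replaceRow (suc i) x M zero    = M zero
  replaceRow (suc i) x M (suc h) = replaceRow i x (M ∘ suc) h

  replaceRow-same : ∀ {n m} (i : Fin n) (x : Row m) M → replaceRow i x M i ≐ x
  replaceRow-same zero    x M k = refl
  replaceRow-same (suc i) x M k = replaceRow-same i x (M ∘ suc) k

  replaceRow-other : ∀ {n m} (i : Fin n) (x : Row m) M h → h ≢ i → replaceRow i x M h ≐ M h
  replaceRow-other zero    x M zero    p k = ⊥-elim (p ≡.refl)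
  replaceRow-other zero    x M (suc h) p k = refl
  replaceRow-other (suc i) x M zero    p k = refl
  replaceRow-other (suc i) x M (suc h) p k = replaceRow-other i x (M ∘ suc) h (p ∘ ≡.cong suc) k

  -- The adjugate in Cramer's form. No signs or minors appear, and the expansion along row `i`
  -- becomes plain linearity in that row.
  adj : ∀ {n} → Rows n n → Rows n n
  adj {n} M j i = det n (replaceRow i (unit j) M)

  unit-diag : ∀ {n} (i : Fin n) → unit i i ≈ 1#
  unit-diag zero    = refl
  unit-diag (suc i) = unit-diag i

  unit-off : ∀ {n} (i j : Fin n) → i ≢ j → unit i j ≈ 0#
  unit-off zero    zero    p = ⊥-elim (p ≡.refl)
  unit-off zero    (suc j) p = refl
  unit-off (suc i) zero    p = refl
  unit-off (suc i) (suc j) p = unit-off i j (p ∘ ≡.cong suc)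

  -- Both sides are the determinant of M with row i replaced by row h.
  ·-adj : ∀ {n} (M : Rows n n) h i → (M · adj M) h i ≈ unit h i * det n M
  ·-adj {n} M h i = trans (sym expand) (evaluate (h ≟ i))
    where
    module D = Alternating (det-alternating n)
    same : ∀ {x y : Row n} → ∀ g → g ≢ i → replaceRow i x M g ≐ replaceRow i y M g
    same g p k = trans (replaceRow-other i _ M g p k) (sym (replaceRow-other i _ M g p k))
    congᵢ : ∀ {x y} → x ≐ y → ∀ g → replaceRow i x M g ≐ replaceRow i y M g
    congᵢ e g k with g ≟ i
    ... | yes ≡.refl = trans (replaceRow-same i _ M k) (trans (e k) (sym (replaceRow-same i _ M k)))
    ... | no p = same g p k
    expand : det n (replaceRow i (M h) M) ≈ (M · adj M) h i
    expand = linear-expansion (λ x → det n (replaceRow i x M)) (λ e → D.cong (congᵢ e))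
      (λ a e → D.linear i a
        (λ k → trans (replaceRow-same i _ M k) (trans (e k)
          (sym (+-cong (*-congˡ (replaceRow-same i _ M k)) (replaceRow-same i _ M k))))) same same) (M h)
    evaluate : Dec (h ≡ i) → det n (replaceRow i (M h) M) ≈ unit h i * det n M
    evaluate (yes ≡.refl) = trans (D.cong lemma) (sym (trans (*-congʳ (unit-diag i)) (*-identityˡ _)))
      where
      lemma : ∀ g → replaceRow i (M i) M g ≐ M g
      lemma g k with g ≟ i
      ... | yes ≡.refl = replaceRow-same i _ M k
      ... | no p = replaceRow-other i _ M g p k
    evaluate (no p) = trans (D.vanish h i _ p (λ k → trans (replaceRow-other i _ M h p k) (sym (replaceRow-same i _ M k))))
      (sym (trans (*-congʳ (unit-off h i p)) (zeroˡ _)))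

open import Defs
open ≡ using (refl; sym; trans; cong; cong₂; subst)
open import Data.List as List using (List; []; _∷_; _++_)
open import Data.List.Relation.Unary.All as All using (All; []; _∷_)
import Data.List.Relation.Unary.All.Properties as Allₚ
open import Data.Vec as Vec using (Vec; []; _∷_)
import Data.Vec.Relation.Unary.All as VAll
open VAll using ([]; _∷_)

-- The rings of Eisenstein integers and of polynomials over them

eisensteinRing : CommutativeRing 0ℓ 0ℓ
eisensteinRing = record
  { Carrier = Eis ; _≈_ = _≡_ ; _+_ = _+E_ ; _*_ = _*E_ ; -_ = -E_ ; 0# = 0E ; 1# = 1E
  ; isCommutativeRing = record
    { isRing = record
      { +-isAbelianGroup = record
        { isGroup = record
          { isMonoid = record
            { isSemigroup = record
              { isMagma = record { isEquivalence = ≡.isEquivalence ; ∙-cong = cong₂ _+E_ }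
              ; assoc = λ x y z → cong₂ _+_ω (ℤ-assoc (re x) (re y) (re z)) (ℤ-assoc (im x) (im y) (im z)) }
            ; identity = (λ x → cong₂ _+_ω (ℤ-idˡ (re x)) (ℤ-idˡ (im x)))
                       , (λ x → cong₂ _+_ω (ℤ-idʳ (re x)) (ℤ-idʳ (im x))) }
          ; inverse = (λ x → cong₂ _+_ω (ℤ-invˡ (re x)) (ℤ-invˡ (im x)))
                    , (λ x → cong₂ _+_ω (ℤ-invʳ (re x)) (ℤ-invʳ (im x)))
          ; ⁻¹-cong = cong -E_ }
        ; comm = λ x y → cong₂ _+_ω (ℤ-comm (re x) (re y)) (ℤ-comm (im x) (im y)) }
      ; *-cong = cong₂ _*E_
      ; *-assoc = λ { (a + b ω) (c + d ω) (e + f ω) → cong₂ _+_ω (assoc₁ a b c d e f) (assoc₂ a b c d e f) }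
      ; *-identity = (λ { (a + b ω) → cong₂ _+_ω (idˡ₁ a b) (idˡ₂ a b) })
                   , (λ { (a + b ω) → cong₂ _+_ω (idʳ₁ a b) (idʳ₂ a b) })
      ; distrib = (λ { (a + b ω) (c + d ω) (e + f ω) → cong₂ _+_ω (distˡ₁ a b c d e f) (distˡ₂ a b c d e f) })
                , (λ { (a + b ω) (c + d ω) (e + f ω) → cong₂ _+_ω (distʳ₁ a b c d e f) (distʳ₂ a b c d e f) })
      }
    ; *-comm = λ { (a + b ω) (c + d ω) → cong₂ _+_ω (comm₁ a b c d) (comm₂ a b c d) }
    }
  }
  where
  open Int using (_+_; _-_; _*_; -_)
  ℤ-assoc : ∀ x y z → x + y + z ≡ x + (y + z)
  ℤ-assoc = solve-∀
  ℤ-idˡ : ∀ x → 0ℤ + x ≡ x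
  ℤ-idˡ = solve-∀
  ℤ-idʳ : ∀ x → x + 0ℤ ≡ x
  ℤ-idʳ = solve-∀
  ℤ-invˡ : ∀ x → - x + x ≡ 0ℤ
  ℤ-invˡ = solve-∀
  ℤ-invʳ : ∀ x → x + - x ≡ 0ℤ
  ℤ-invʳ = solve-∀
  ℤ-comm : ∀ x y → x + y ≡ y + x
  ℤ-comm = solve-∀
  assoc₁ : ∀ a b c d e f → (a * c - b * d) * e - (a * d + b * c - b * d) * f
                         ≡ a * (c * e - d * f) - b * (c * f + d * e - d * f)
  assoc₁ = solve-∀
  assoc₂ : ∀ a b c d e f →
    (a * c - b * d) * f + (a * d + b * c - b * d) * e - (a * d + b * c - b * d) * f
    ≡ a * (c * f + d * e - d * f) + b * (c * e - d * f) - b * (c * f + d * e - d * f)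
  assoc₂ = solve-∀
  idˡ₁ : ∀ a b → 1ℤ * a - 0ℤ * b ≡ a
  idˡ₁ = solve-∀
  idˡ₂ : ∀ a b → 1ℤ * b + 0ℤ * a - 0ℤ * b ≡ b
  idˡ₂ = solve-∀
  idʳ₁ : ∀ a b → a * 1ℤ - b * 0ℤ ≡ a
  idʳ₁ = solve-∀
  idʳ₂ : ∀ a b → a * 0ℤ + b * 1ℤ - b * 0ℤ ≡ b
  idʳ₂ = solve-∀
  distˡ₁ : ∀ a b c d e f → a * (c + e) - b * (d + f) ≡ (a * c - b * d) + (a * e - b * f)
  distˡ₁ = solve-∀
  distˡ₂ : ∀ a b c d e f → a * (d + f) + b * (c + e) - b * (d + f)
                         ≡ (a * d + b * c - b * d) + (a * f + b * e - b * f)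
  distˡ₂ = solve-∀
  distʳ₁ : ∀ a b c d e f → (c + e) * a - (d + f) * b ≡ (c * a - d * b) + (e * a - f * b)
  distʳ₁ = solve-∀
  distʳ₂ : ∀ a b c d e f → (c + e) * b + (d + f) * a - (d + f) * b
                         ≡ (c * b + d * a - d * b) + (e * b + f * a - f * b)
  distʳ₂ = solve-∀
  comm₁ : ∀ a b c d → a * c - b * d ≡ c * a - d * b
  comm₁ = solve-∀
  comm₂ : ∀ a b c d → a * d + b * c - b * d ≡ c * b + d * a - d * b
  comm₂ = solve-∀

module 𝔼 = CommutativeRing eisensteinRing

-- Recognising the zero coefficient lets the solver cancel terms.
eisenstein-acr : AlmostCommutativeRing 0ℓ 0ℓ
eisenstein-acr = fromCommutativeRing eisensteinRing
  λ { ((Int.+ 0) + (Int.+ 0) ω) → just refl ; _ → nothing }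



-- Wrapping _≈ₚ_ lets the two polynomials be inferred.
infix 4 _≋_
record _≋_ (p q : Poly) : Set where
  constructor mk
  field coeffs : p ≈ₚ q
open _≋_

≋-refl : ∀ {p} → p ≋ p
≋-refl = mk λ _ → refl

≋-sym : ∀ {p q} → p ≋ q → q ≋ p
≋-sym e = mk λ k → sym (coeffs e k)

≋-trans : ∀ {p q r} → p ≋ q → q ≋ r → p ≋ r
≋-trans e f = mk λ k → trans (coeffs e k) (coeffs f k)

coeff-+ : ∀ k p q → coeff k (p +ₚ q) ≡ coeff k p +E coeff k q
coeff-+ k       []      q       = sym (𝔼.+-identityˡ _)
coeff-+ k       (a ∷ p) []      = sym (𝔼.+-identityʳ _)
coeff-+ zero    (a ∷ p) (b ∷ q) = refl
coeff-+ (suc k) (a ∷ p) (b ∷ q) = coeff-+ k p q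

coeff-neg : ∀ k p → coeff k (-ₚ p) ≡ -E coeff k p
coeff-neg k       []      = refl
coeff-neg zero    (a ∷ p) = refl
coeff-neg (suc k) (a ∷ p) = coeff-neg k p

coeff-scale : ∀ k a p → coeff k (scaleₚ a p) ≡ a *E coeff k p
coeff-scale k       a []      = sym (𝔼.zeroʳ a)
coeff-scale zero    a (b ∷ p) = refl
coeff-scale (suc k) a (b ∷ p) = coeff-scale k a p

∷-cong : ∀ {a b p q} → a ≡ b → p ≋ q → a ∷ p ≋ b ∷ q
∷-cong e f = mk λ { zero → e ; (suc k) → coeffs f k }

+ₚ-cong : ∀ {p p′ q q′} → p ≋ p′ → q ≋ q′ → p +ₚ q ≋ p′ +ₚ q′
+ₚ-cong {p} {p′} {q} {q′} e f = mk λ k →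
  trans (coeff-+ k p q) (trans (cong₂ _+E_ (coeffs e k) (coeffs f k)) (sym (coeff-+ k p′ q′)))

-ₚ-cong : ∀ {p q} → p ≋ q → -ₚ p ≋ -ₚ q
-ₚ-cong {p} {q} e = mk λ k → trans (coeff-neg k p) (trans (cong -E_ (coeffs e k)) (sym (coeff-neg k q)))

scale-cong : ∀ a {p q} → p ≋ q → scaleₚ a p ≋ scaleₚ a q
scale-cong a {p} {q} e = mk λ k → trans (coeff-scale k a p) (trans (cong (a *E_) (coeffs e k)) (sym (coeff-scale k a q)))

+ₚ-assoc : ∀ p q r → (p +ₚ q) +ₚ r ≋ p +ₚ (q +ₚ r)
+ₚ-assoc p q r = mk λ k → begin
  coeff k ((p +ₚ q) +ₚ r)                     ≡⟨ coeff-+ k (p +ₚ q) r ⟩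
  coeff k (p +ₚ q) +E coeff k r               ≡⟨ cong (_+E coeff k r) (coeff-+ k p q) ⟩
  (coeff k p +E coeff k q) +E coeff k r       ≡⟨ 𝔼.+-assoc (coeff k p) (coeff k q) (coeff k r) ⟩
  coeff k p +E (coeff k q +E coeff k r)       ≡⟨ cong (coeff k p +E_) (coeff-+ k q r) ⟨
  coeff k p +E coeff k (q +ₚ r)               ≡⟨ coeff-+ k p (q +ₚ r) ⟨
  coeff k (p +ₚ (q +ₚ r))                     ∎
  where open ≡.≡-Reasoning

+ₚ-comm : ∀ p q → p +ₚ q ≋ q +ₚ p
+ₚ-comm p q = mk λ k → trans (coeff-+ k p q) (trans (𝔼.+-comm (coeff k p) _) (sym (coeff-+ k q p)))

+ₚ-identityʳ : ∀ p → p +ₚ [] ≋ p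
+ₚ-identityʳ p = +ₚ-comm p []

+ₚ-inverseʳ : ∀ p → p +ₚ (-ₚ p) ≋ []
+ₚ-inverseʳ p = mk λ k → trans (coeff-+ k p (-ₚ p))
  (trans (cong (coeff k p +E_) (coeff-neg k p)) (𝔼.-‿inverseʳ (coeff k p)))

+ₚ-interchange : ∀ p q r s → (p +ₚ q) +ₚ (r +ₚ s) ≋ (p +ₚ r) +ₚ (q +ₚ s)
+ₚ-interchange p q r s = mk λ k → begin
  coeff k ((p +ₚ q) +ₚ (r +ₚ s))      ≡⟨ expand k p q r s ⟩
  (coeff k p +E coeff k q) +E (coeff k r +E coeff k s) ≡⟨ rearrange (coeff k p) (coeff k q) (coeff k r) (coeff k s) ⟩
  (coeff k p +E coeff k r) +E (coeff k q +E coeff k s) ≡⟨ expand k p r q s ⟨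
  coeff k ((p +ₚ r) +ₚ (q +ₚ s))      ∎
  where
  open ≡.≡-Reasoning
  expand : ∀ k p q r s → coeff k ((p +ₚ q) +ₚ (r +ₚ s)) ≡ (coeff k p +E coeff k q) +E (coeff k r +E coeff k s)
  expand k p q r s = trans (coeff-+ k (p +ₚ q) (r +ₚ s)) (cong₂ _+E_ (coeff-+ k p q) (coeff-+ k r s))
  rearrange : ∀ a b c d → (a +E b) +E (c +E d) ≡ (a +E c) +E (b +E d)
  rearrange = Tactic.RingSolver.solve-∀ eisenstein-acr

scale-+ : ∀ a p q → scaleₚ a (p +ₚ q) ≋ scaleₚ a p +ₚ scaleₚ a q
scale-+ a p q = mk λ k → begin
  coeff k (scaleₚ a (p +ₚ q))                      ≡⟨ coeff-scale k a (p +ₚ q) ⟩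
  a *E coeff k (p +ₚ q)                            ≡⟨ cong (a *E_) (coeff-+ k p q) ⟩
  a *E (coeff k p +E coeff k q)                    ≡⟨ 𝔼.distribˡ a (coeff k p) (coeff k q) ⟩
  (a *E coeff k p) +E (a *E coeff k q)             ≡⟨ cong₂ _+E_ (coeff-scale k a p) (coeff-scale k a q) ⟨
  coeff k (scaleₚ a p) +E coeff k (scaleₚ a q)     ≡⟨ coeff-+ k (scaleₚ a p) (scaleₚ a q) ⟨
  coeff k (scaleₚ a p +ₚ scaleₚ a q)               ∎
  where open ≡.≡-Reasoning

scale-scale : ∀ a b p → scaleₚ a (scaleₚ b p) ≋ scaleₚ (a *E b) p
scale-scale a b p = mk λ k → begin
  coeff k (scaleₚ a (scaleₚ b p))  ≡⟨ coeff-scale k a (scaleₚ b p) ⟩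
  a *E coeff k (scaleₚ b p)        ≡⟨ cong (a *E_) (coeff-scale k b p) ⟩
  a *E (b *E coeff k p)            ≡⟨ 𝔼.*-assoc a b (coeff k p) ⟨
  (a *E b) *E coeff k p            ≡⟨ coeff-scale k (a *E b) p ⟨
  coeff k (scaleₚ (a *E b) p)      ∎
  where open ≡.≡-Reasoning

scale-zero : ∀ p → scaleₚ 0E p ≋ []
scale-zero p = mk λ k → trans (coeff-scale k 0E p) (𝔼.zeroˡ (coeff k p))

scale-one : ∀ p → scaleₚ 1E p ≋ p
scale-one p = mk λ k → trans (coeff-scale k 1E p) (𝔼.*-identityˡ (coeff k p))

shift-[] : 0E ∷ [] ≋ []
shift-[] = mk λ { zero → refl ; (suc k) → refl }


*ₚ-congʳ : ∀ p {q q′} → q ≋ q′ → p *ₚ q ≋ p *ₚ q′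
*ₚ-congʳ []      e = ≋-refl
*ₚ-congʳ (a ∷ p) e = +ₚ-cong (scale-cong a e) (∷-cong refl (*ₚ-congʳ p e))

*ₚ-zeroʳ : ∀ p → p *ₚ [] ≋ []
*ₚ-zeroʳ []      = ≋-refl
*ₚ-zeroʳ (a ∷ p) = ≋-trans (∷-cong refl (*ₚ-zeroʳ p)) shift-[]

-- Multiplication recurses on its left factor; the matching recursion on the right factor is what
-- commutativity needs.
*ₚ-∷ʳ : ∀ p b q → p *ₚ (b ∷ q) ≋ scaleₚ b p +ₚ (0E ∷ (p *ₚ q))
*ₚ-∷ʳ []      b q = ≋-sym shift-[]
*ₚ-∷ʳ (a ∷ p) b q = ∷-cong (cong (_+E 0E) (𝔼.*-comm a b)) (≋-trans
  (+ₚ-cong (≋-refl {scaleₚ a q}) (*ₚ-∷ʳ p b q))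
  (≋-trans (≋-sym (+ₚ-assoc (scaleₚ a q) (scaleₚ b p) (0E ∷ (p *ₚ q))))
  (≋-trans (+ₚ-cong (+ₚ-comm (scaleₚ a q) (scaleₚ b p)) (≋-refl {0E ∷ (p *ₚ q)}))
  (+ₚ-assoc (scaleₚ b p) (scaleₚ a q) (0E ∷ (p *ₚ q))))))

*ₚ-comm : ∀ p q → p *ₚ q ≋ q *ₚ p
*ₚ-comm []      q = ≋-sym (*ₚ-zeroʳ q)
*ₚ-comm (a ∷ p) q = ≋-trans (+ₚ-cong (≋-refl {scaleₚ a q}) (∷-cong {0E} refl (*ₚ-comm p q))) (≋-sym (*ₚ-∷ʳ q a p))

*ₚ-cong : ∀ {p p′ q q′} → p ≋ p′ → q ≋ q′ → p *ₚ q ≋ p′ *ₚ q′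
*ₚ-cong {p} {p′} {q} {q′} e f = ≋-trans (*ₚ-congʳ p f) (≋-trans (*ₚ-comm p q′)
  (≋-trans (*ₚ-congʳ q′ e) (*ₚ-comm q′ p′)))

*ₚ-distribˡ : ∀ p q r → p *ₚ (q +ₚ r) ≋ (p *ₚ q) +ₚ (p *ₚ r)
*ₚ-distribˡ []      q r = ≋-refl
*ₚ-distribˡ (a ∷ p) q r = ≋-trans
  (+ₚ-cong (scale-+ a q r) (∷-cong (sym (𝔼.+-identityˡ 0E)) (*ₚ-distribˡ p q r)))
  (+ₚ-interchange (scaleₚ a q) (scaleₚ a r) (0E ∷ (p *ₚ q)) (0E ∷ (p *ₚ r)))

*ₚ-distribʳ : ∀ p q r → (q +ₚ r) *ₚ p ≋ (q *ₚ p) +ₚ (r *ₚ p)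
*ₚ-distribʳ p q r = ≋-trans (*ₚ-comm (q +ₚ r) p) (≋-trans (*ₚ-distribˡ p q r)
  (+ₚ-cong (*ₚ-comm p q) (*ₚ-comm p r)))

scale-* : ∀ a q r → scaleₚ a q *ₚ r ≋ scaleₚ a (q *ₚ r)
scale-* a []      r = ≋-refl
scale-* a (b ∷ q) r = ≋-trans
  (+ₚ-cong (≋-sym (scale-scale a b r)) (∷-cong (sym (𝔼.zeroʳ a)) (scale-* a q r)))
  (≋-sym (scale-+ a (scaleₚ b r) (0E ∷ (q *ₚ r))))

*ₚ-assoc : ∀ p q r → (p *ₚ q) *ₚ r ≋ p *ₚ (q *ₚ r)
*ₚ-assoc []      q r = ≋-refl
*ₚ-assoc (a ∷ p) q r = ≋-trans (*ₚ-distribʳ r (scaleₚ a q) (0E ∷ (p *ₚ q)))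
  (+ₚ-cong (scale-* a q r) (≋-trans (+ₚ-cong (scale-zero r) (≋-refl {0E ∷ ((p *ₚ q) *ₚ r)}))
    (∷-cong refl (*ₚ-assoc p q r))))

*ₚ-identityˡ : ∀ p → oneₚ *ₚ p ≋ p
*ₚ-identityˡ p = ≋-trans (+ₚ-cong (scale-one p) shift-[]) (+ₚ-identityʳ p)

polyRing : CommutativeRing 0ℓ 0ℓ
polyRing = record
  { Carrier = Poly ; _≈_ = _≋_ ; _+_ = _+ₚ_ ; _*_ = _*ₚ_ ; -_ = -ₚ_ ; 0# = [] ; 1# = oneₚ
  ; isCommutativeRing = record
    { isRing = record
      { +-isAbelianGroup = record
        { isGroup = record
          { isMonoid = record
            { isSemigroup = record
              { isMagma = record
                { isEquivalence = record { refl = ≋-refl ; sym = ≋-sym ; trans = ≋-trans }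
                ; ∙-cong = +ₚ-cong }
              ; assoc = +ₚ-assoc }
            ; identity = (λ p → ≋-refl) , +ₚ-identityʳ }
          ; inverse = (λ p → ≋-trans (+ₚ-comm (-ₚ p) p) (+ₚ-inverseʳ p)) , +ₚ-inverseʳ
          ; ⁻¹-cong = -ₚ-cong }
        ; comm = +ₚ-comm }
      ; *-cong = *ₚ-cong
      ; *-assoc = *ₚ-assoc
      ; *-identity = *ₚ-identityˡ , (λ p → ≋-trans (*ₚ-comm p oneₚ) (*ₚ-identityˡ p))
      ; distrib = *ₚ-distribˡ , *ₚ-distribʳ
      }
    ; *-comm = *ₚ-comm
    }
  }

-- The norm and the absence of zero divisors

-- Four times the usual norm: 4(a² − ab + b²) = (2a − b)² + 3b².
norm₄ : Eis → ℕ
norm₄ (a + b ω) = Int.∣ Int.+ 2 Int.* a Int.- b ∣ ℕ.* Int.∣ Int.+ 2 Int.* a Int.- b ∣ ℕ.+ 3 ℕ.* (Int.∣ b ∣ ℕ.* Int.∣ b ∣)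

+∣i∣*∣i∣≡i*i : ∀ i → Int.+ (Int.∣ i ∣ ℕ.* Int.∣ i ∣) ≡ i Int.* i
+∣i∣*∣i∣≡i*i (Int.+ n)      = ℤₚ.pos-* n n
+∣i∣*∣i∣≡i*i (Int.-[1+ n ]) = refl

norm₄-formula : ∀ a b → Int.+ norm₄ (a + b ω) ≡ Int.+ 4 Int.* (a Int.* a Int.- a Int.* b Int.+ b Int.* b)
norm₄-formula a b = begin
  Int.+ norm₄ (a + b ω)
    ≡⟨ ℤₚ.pos-+ (Int.∣ Int.+ 2 Int.* a Int.- b ∣ ℕ.* Int.∣ Int.+ 2 Int.* a Int.- b ∣) (3 ℕ.* (Int.∣ b ∣ ℕ.* Int.∣ b ∣)) ⟩
  Int.+ (Int.∣ Int.+ 2 Int.* a Int.- b ∣ ℕ.* Int.∣ Int.+ 2 Int.* a Int.- b ∣) Int.+ Int.+ (3 ℕ.* (Int.∣ b ∣ ℕ.* Int.∣ b ∣))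
    ≡⟨ cong₂ Int._+_ (+∣i∣*∣i∣≡i*i (Int.+ 2 Int.* a Int.- b))
         (trans (ℤₚ.pos-* 3 (Int.∣ b ∣ ℕ.* Int.∣ b ∣)) (cong (Int.+ 3 Int.*_) (+∣i∣*∣i∣≡i*i b))) ⟩
  (Int.+ 2 Int.* a Int.- b) Int.* (Int.+ 2 Int.* a Int.- b) Int.+ Int.+ 3 Int.* (b Int.* b)
    ≡⟨ complete-square a b ⟩
  Int.+ 4 Int.* (a Int.* a Int.- a Int.* b Int.+ b Int.* b) ∎
  where
  open ≡.≡-Reasoning
  complete-square : ∀ a b → (Int.+ 2 Int.* a Int.- b) Int.* (Int.+ 2 Int.* a Int.- b) Int.+ Int.+ 3 Int.* (b Int.* b)
                          ≡ Int.+ 4 Int.* (a Int.* a Int.- a Int.* b Int.+ b Int.* b)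
  complete-square = solve-∀

norm₄-* : ∀ x y → norm₄ x ℕ.* norm₄ y ≡ 4 ℕ.* norm₄ (x *E y)
norm₄-* x@(a + b ω) y@(c + d ω) = ℤₚ.+-injective (begin
  Int.+ (norm₄ x ℕ.* norm₄ y)           ≡⟨ ℤₚ.pos-* (norm₄ x) (norm₄ y) ⟩
  Int.+ norm₄ x Int.* Int.+ norm₄ y     ≡⟨ cong₂ Int._*_ (norm₄-formula a b) (norm₄-formula c d) ⟩
  _                                     ≡⟨ multiplicative a b c d ⟩
  _                                     ≡⟨ cong (Int.+ 4 Int.*_) (norm₄-formula (re (x *E y)) (im (x *E y))) ⟨
  Int.+ 4 Int.* Int.+ norm₄ (x *E y)    ≡⟨ ℤₚ.pos-* 4 (norm₄ (x *E y)) ⟨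
  Int.+ (4 ℕ.* norm₄ (x *E y))          ∎)
  where
  open ≡.≡-Reasoning
  open Int using (_+_; _-_; _*_; +_)
  multiplicative : ∀ a b c d →
    (+ 4 * (a * a - a * b + b * b)) * (+ 4 * (c * c - c * d + d * d)) ≡
    + 4 * (+ 4 * ((a * c - b * d) * (a * c - b * d) - (a * c - b * d) * (a * d + b * c - b * d)
                  + (a * d + b * c - b * d) * (a * d + b * c - b * d)))
  multiplicative = solve-∀

-- The factor 4 completes the square, so the norm is a sum of two natural numbers that must vanish
-- separately.
norm₄≡0⇒≡0 : ∀ x → norm₄ x ≡ 0 → x ≡ 0E
norm₄≡0⇒≡0 (a + b ω) e = cong₂ _+_ω a≡0 b≡0
  where
  m*m≡0 : ∀ m → m ℕ.* m ≡ 0 → m ≡ 0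
  m*m≡0 m p = Sum.reduce (ℕₚ.m*n≡0⇒m≡0∨n≡0 m p)
  b≡0 : b ≡ 0ℤ
  b≡0 = ℤₚ.∣i∣≡0⇒i≡0 (m*m≡0 Int.∣ b ∣ (ℕₚ.m+n≡0⇒m≡0 (Int.∣ b ∣ ℕ.* Int.∣ b ∣)
    (ℕₚ.m+n≡0⇒n≡0 (Int.∣ Int.+ 2 Int.* a Int.- b ∣ ℕ.* Int.∣ Int.+ 2 Int.* a Int.- b ∣) e)))
  2a-b≡0 : Int.+ 2 Int.* a Int.- b ≡ 0ℤ
  2a-b≡0 = ℤₚ.∣i∣≡0⇒i≡0 (m*m≡0 Int.∣ Int.+ 2 Int.* a Int.- b ∣ (ℕₚ.m+n≡0⇒m≡0 (Int.∣ Int.+ 2 Int.* a Int.- b ∣ ℕ.* Int.∣ Int.+ 2 Int.* a Int.- b ∣) e))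
  2a≡0 : Int.+ 2 Int.* a ≡ 0ℤ
  2a≡0 = trans (ℤₚ.i-j≡0⇒i≡j (Int.+ 2 Int.* a) b 2a-b≡0) b≡0
  a≡0 : a ≡ 0ℤ
  a≡0 with ℤₚ.i*j≡0⇒i≡0∨j≡0 (Int.+ 2) 2a≡0
  ... | inj₁ ()
  ... | inj₂ p = p

*E≡0⇒≡0 : ∀ x y → x *E y ≡ 0E → x ≡ 0E ⊎ y ≡ 0E
*E≡0⇒≡0 x y e = Sum.map (norm₄≡0⇒≡0 x) (norm₄≡0⇒≡0 y)
  (ℕₚ.m*n≡0⇒m≡0∨n≡0 (norm₄ x) (trans (norm₄-* x y) (cong (λ z → 4 ℕ.* norm₄ z) e)))

-- Monic polynomials and division by linear factors

-- Coefficient lists may end in zeros, so degrees are bounded through coefficients and not through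
-- length.
DegreeBelow : ℕ → Poly → Set
DegreeBelow n p = ∀ k → coeff (n ℕ.+ k) p ≡ 0E

Monic : ℕ → Poly → Set
Monic n p = coeff n p ≡ 1E × DegreeBelow (suc n) p

linFactor : Eis → Poly
linFactor c = Xₚ -ₚ constₚ c

linFactor-monic : ∀ c → Monic 1 (linFactor c)
linFactor-monic c = refl , λ k → refl

coeff-shift : ∀ k p → p ≋ [] → coeff k (0E ∷ p) ≡ 0E
coeff-shift zero    p e = refl
coeff-shift (suc k) p e = coeffs e k

coeff-*-∷ : ∀ k p b q → coeff k (p *ₚ (b ∷ q)) ≡ (b *E coeff k p) +E coeff k (0E ∷ (p *ₚ q))
coeff-*-∷ k p b q = trans (coeffs (*ₚ-∷ʳ p b q) k)
  (trans (coeff-+ k (scaleₚ b p) (0E ∷ (p *ₚ q))) (cong (_+E coeff k (0E ∷ (p *ₚ q))) (coeff-scale k b p)))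

-- Write the second factor as b + Xg. Above degree n the term bf contributes nothing, so fg again
-- has degree below n and g = 0 by induction; then the coefficient of degree n in the product is b.
monic-cancel : ∀ n f g → Monic n f → DegreeBelow n (f *ₚ g) → g ≋ []
monic-cancel n f []      monic         below = ≋-refl
monic-cancel n f (b ∷ g) (lead , high) below = ≋-trans (∷-cong b≡0 g≋0) shift-[]
  where
  open ≡.≡-Reasoning
  below′ : DegreeBelow n (f *ₚ g)
  below′ k = begin
    coeff (n ℕ.+ k) (f *ₚ g)
      ≡⟨ 𝔼.+-identityˡ _ ⟨
    0E +E coeff (n ℕ.+ k) (f *ₚ g)
      ≡⟨ cong (_+E coeff (n ℕ.+ k) (f *ₚ g)) (trans (cong (b *E_) (high k)) (𝔼.zeroʳ b)) ⟨
    (b *E coeff (suc (n ℕ.+ k)) f) +E coeff (n ℕ.+ k) (f *ₚ g)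
      ≡⟨ coeff-*-∷ (suc (n ℕ.+ k)) f b g ⟨
    coeff (suc (n ℕ.+ k)) (f *ₚ (b ∷ g))
      ≡⟨ cong (λ i → coeff i (f *ₚ (b ∷ g))) (ℕₚ.+-suc n k) ⟨
    coeff (n ℕ.+ suc k) (f *ₚ (b ∷ g))
      ≡⟨ below (suc k) ⟩
    0E ∎
  g≋0 : g ≋ []
  g≋0 = monic-cancel n f g (lead , high) below′
  b≡0 : b ≡ 0E
  b≡0 = begin
    b                                                    ≡⟨ 𝔼.*-identityʳ b ⟨
    b *E 1E                                              ≡⟨ cong (b *E_) lead ⟨
    b *E coeff n f                                       ≡⟨ 𝔼.+-identityʳ _ ⟨
    (b *E coeff n f) +E 0E
      ≡⟨ cong ((b *E coeff n f) +E_) (coeff-shift n (f *ₚ g) (≋-trans (*ₚ-congʳ f g≋0) (*ₚ-zeroʳ f))) ⟨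
    (b *E coeff n f) +E coeff n (0E ∷ (f *ₚ g))          ≡⟨ coeff-*-∷ n f b g ⟨
    coeff n (f *ₚ (b ∷ g))                               ≡⟨ cong (λ i → coeff i (f *ₚ (b ∷ g))) (ℕₚ.+-identityʳ n) ⟨
    coeff (n ℕ.+ 0) (f *ₚ (b ∷ g))                       ≡⟨ below 0 ⟩
    0E                                                   ∎

coeff-binomial : ∀ k a b q → coeff (suc k) ((a ∷ b ∷ []) *ₚ q) ≡ (a *E coeff (suc k) q) +E (b *E coeff k q)
coeff-binomial k a b q = begin
  coeff (suc k) (scaleₚ a q +ₚ (0E ∷ (scaleₚ b q +ₚ (0E ∷ []))))
    ≡⟨ coeff-+ (suc k) (scaleₚ a q) (0E ∷ (scaleₚ b q +ₚ (0E ∷ []))) ⟩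
  coeff (suc k) (scaleₚ a q) +E coeff k (scaleₚ b q +ₚ (0E ∷ []))
    ≡⟨ cong₂ _+E_ (coeff-scale (suc k) a q)
         (trans (coeffs (≋-trans (+ₚ-cong (≋-refl {scaleₚ b q}) shift-[]) (+ₚ-identityʳ (scaleₚ b q))) k) (coeff-scale k b q)) ⟩
  (a *E coeff (suc k) q) +E (b *E coeff k q) ∎
  where open ≡.≡-Reasoning

coeff₀-binomial : ∀ a b q → coeff 0 ((a ∷ b ∷ []) *ₚ q) ≡ a *E coeff 0 q
coeff₀-binomial a b q = trans (coeff-+ 0 (scaleₚ a q) (0E ∷ ((b ∷ []) *ₚ q)))
  (trans (𝔼.+-identityʳ _) (coeff-scale 0 a q))

-- Horner's scheme for the value at d. Its intermediate values are the coefficients of `quotient`,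
-- which is synthetic division by X - d.
remainder : Eis → Poly → Eis
remainder d []      = 0E
remainder d (a ∷ p) = a +E (d *E remainder d p)

quotient : Eis → Poly → Poly
quotient d []      = []
quotient d (a ∷ p) = remainder d p ∷ quotient d p

division : ∀ d p → p ≋ (linFactor d *ₚ quotient d p) +ₚ constₚ (remainder d p)
division d p = mk λ k → trans (coefficientwise k p) (sym (coeff-+ k (linFactor d *ₚ quotient d p) (constₚ (remainder d p))))
  where
  open ≡.≡-Reasoning
  e₀ : ∀ a d r → a ≡ ((0E +E (-E d)) *E r) +E (a +E (d *E r))
  e₀ = Tactic.RingSolver.solve-∀ eisenstein-acr
  e₁ : ∀ d x r → ((0E +E (-E d)) *E x) +E r ≡ (((0E +E (-E d)) *E x) +E (1E *E r)) +E 0E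
  e₁ = Tactic.RingSolver.solve-∀ eisenstein-acr
  coefficientwise : ∀ k p → coeff k p ≡ coeff k (linFactor d *ₚ quotient d p) +E coeff k (constₚ (remainder d p))
  coefficientwise zero [] = coeffs (≋-sym (≋-trans (+ₚ-cong (*ₚ-zeroʳ (linFactor d)) (≋-refl {[]})) ≋-refl)) 0
  coefficientwise (suc k) [] = sym (trans (𝔼.+-identityʳ _) (coeffs (*ₚ-zeroʳ (linFactor d)) (suc k)))
  coefficientwise zero (a ∷ p) = trans (e₀ a d (remainder d p))
    (cong (_+E (a +E (d *E remainder d p))) (sym (coeff₀-binomial (0E +E (-E d)) 1E (quotient d (a ∷ p)))))
  coefficientwise (suc zero) (a ∷ p) = begin
    coeff 0 p
      ≡⟨ coefficientwise 0 p ⟩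
    coeff 0 (linFactor d *ₚ quotient d p) +E remainder d p
      ≡⟨ cong (_+E remainder d p) (coeff₀-binomial (0E +E (-E d)) 1E (quotient d p)) ⟩
    ((0E +E (-E d)) *E coeff 0 (quotient d p)) +E remainder d p
      ≡⟨ e₁ d (coeff 0 (quotient d p)) (remainder d p) ⟩
    (((0E +E (-E d)) *E coeff 0 (quotient d p)) +E (1E *E remainder d p)) +E 0E
      ≡⟨ cong (_+E 0E) (coeff-binomial 0 (0E +E (-E d)) 1E (quotient d (a ∷ p))) ⟨
    coeff 1 (linFactor d *ₚ quotient d (a ∷ p)) +E 0E ∎
  coefficientwise (suc (suc k)) (a ∷ p) = begin
    coeff (suc k) p
      ≡⟨ coefficientwise (suc k) p ⟩
    coeff (suc k) (linFactor d *ₚ quotient d p) +E 0E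
      ≡⟨ cong (_+E 0E) (coeff-binomial k (0E +E (-E d)) 1E (quotient d p)) ⟩
    (((0E +E (-E d)) *E coeff (suc k) (quotient d p)) +E (1E *E coeff k (quotient d p))) +E 0E
      ≡⟨ cong (_+E 0E) (coeff-binomial (suc k) (0E +E (-E d)) 1E (quotient d (a ∷ p))) ⟨
    coeff (suc (suc k)) (linFactor d *ₚ quotient d (a ∷ p)) +E 0E ∎

tail-≋ : ∀ {a p} → a ∷ p ≋ [] → p ≋ []
tail-≋ e = mk λ k → coeffs e (suc k)

remainder-zero : ∀ d p → p ≋ [] → remainder d p ≡ 0E
remainder-zero d []      e = refl
remainder-zero d (a ∷ p) e = trans
  (cong₂ (λ x y → x +E (d *E y)) (coeffs e 0) (remainder-zero d p (tail-≋ e)))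
  (trans (𝔼.+-identityˡ _) (𝔼.zeroʳ d))

quotient-zero : ∀ d p → p ≋ [] → quotient d p ≋ []
quotient-zero d []      e = ≋-refl
quotient-zero d (a ∷ p) e = ≋-trans
  (∷-cong (remainder-zero d p (tail-≋ e)) (quotient-zero d p (tail-≋ e))) shift-[]

quotient-monic : ∀ n d p → Monic (suc n) p → Monic n (quotient d p)
quotient-monic n       d []      (() , _)
quotient-monic zero    d (a ∷ []) (() , _)
quotient-monic zero    d (a ∷ b ∷ p) (lead , high) = trans
    (cong₂ (λ x y → x +E (d *E y)) lead (remainder-zero d p (mk high)))
    (trans (cong (1E +E_) (𝔼.zeroʳ d)) (𝔼.+-identityʳ 1E))
  , coeffs (≋-trans (∷-cong (remainder-zero d p (mk high)) (quotient-zero d p (mk high))) shift-[])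
quotient-monic (suc n) d (a ∷ p) monic = quotient-monic n d p monic

-- The identities given to this solver involve no cancellation, so it gets no zero test.
polyRing-acr : AlmostCommutativeRing 0ℓ 0ℓ
polyRing-acr = fromCommutativeRing polyRing (λ _ → nothing)

linProdₗ : List Eis → Poly
linProdₗ cs = linProd (Vec.fromList cs)

module ℙ = CommutativeRing polyRing
module ℙₚ = Algebra.Properties.Ring ℙ.ring

*ₚ-cancel-diff : ∀ l h u c → l *ₚ h ≋ (l *ₚ u) +ₚ c → l *ₚ (h -ₚ u) ≋ c
*ₚ-cancel-diff l h u c e = begin
  l *ₚ (h -ₚ u)                        ≈⟨ ℙ.distribˡ l h (-ₚ u) ⟩
  (l *ₚ h) +ₚ (l *ₚ (-ₚ u))            ≈⟨ ℙ.+-cong e (ℙ.sym (ℙₚ.-‿distribʳ-* l u)) ⟩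
  ((l *ₚ u) +ₚ c) +ₚ (-ₚ (l *ₚ u))     ≈⟨ ℙₚ.xyx⁻¹≈y (l *ₚ u) c ⟩
  c                                    ∎
  where open ≈-Reasoning ℙ.setoid

linFactor-cancel : ∀ d p q → linFactor d *ₚ p ≋ linFactor d *ₚ q → p ≋ q
linFactor-cancel d p q e = ℙₚ.x∙y⁻¹≈ε⇒x≈y p q (monic-cancel 1 (linFactor d) (p -ₚ q) (linFactor-monic d)
  (λ k → coeffs (*ₚ-cancel-diff (linFactor d) p q [] (≋-trans e (≋-sym (+ₚ-identityʳ _)))) (suc k)))

constₚ-zero : ∀ {a} → a ≡ 0E → constₚ a ≋ []
constₚ-zero refl = shift-[]

-- The linear factor is prime: modulo X - d the product fg is the constant rs, and a constant
-- multiple of a monic polynomial of degree 1 is zero. One of r and s then vanishes, as ℤ[ω] is a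
-- domain.
root-of-product : ∀ d f g h → f *ₚ g ≋ linFactor d *ₚ h → remainder d f ≡ 0E ⊎ remainder d g ≡ 0E
root-of-product d f g h e = *E≡0⇒≡0 r s (trans (sym (𝔼.+-identityʳ (r *E s))) (coeffs const≋0 0))
  where
  open ≈-Reasoning ℙ.setoid
  L = linFactor d
  f′ = quotient d f
  g′ = quotient d g
  r = remainder d f
  s = remainder d g
  u = (f′ *ₚ ((L *ₚ g′) +ₚ constₚ s)) +ₚ (constₚ r *ₚ g′)
  expand : ∀ l f g r s → ((l *ₚ f) +ₚ r) *ₚ ((l *ₚ g) +ₚ s) ≋ (l *ₚ ((f *ₚ ((l *ₚ g) +ₚ s)) +ₚ (r *ₚ g))) +ₚ (r *ₚ s)
  expand = Tactic.RingSolver.solve-∀ polyRing-acr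
  Lh≋ : L *ₚ h ≋ (L *ₚ u) +ₚ (constₚ r *ₚ constₚ s)
  Lh≋ = begin
    L *ₚ h                                                    ≈⟨ e ⟨
    f *ₚ g                                                    ≈⟨ *ₚ-cong (division d f) (division d g) ⟩
    ((L *ₚ f′) +ₚ constₚ r) *ₚ ((L *ₚ g′) +ₚ constₚ s)        ≈⟨ expand L f′ g′ (constₚ r) (constₚ s) ⟩
    (L *ₚ u) +ₚ (constₚ r *ₚ constₚ s)                        ∎
  diff : L *ₚ (h -ₚ u) ≋ constₚ r *ₚ constₚ s
  diff = *ₚ-cancel-diff L h u _ Lh≋
  const≋0 : constₚ r *ₚ constₚ s ≋ []
  const≋0 = ≋-trans (≋-sym diff) (≋-trans
    (*ₚ-congʳ L (monic-cancel 1 L (h -ₚ u) (linFactor-monic d) (λ k → coeffs diff (suc k)))) (*ₚ-zeroʳ L))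

exact-division : ∀ d p → remainder d p ≡ 0E → p ≋ linFactor d *ₚ quotient d p
exact-division d p e = ≋-trans (division d p)
  (≋-trans (+ₚ-cong (≋-refl {linFactor d *ₚ quotient d p}) (constₚ-zero e)) (+ₚ-identityʳ _))

monic₀ : ∀ f → Monic 0 f → f ≋ oneₚ
monic₀ f (lead , high) = mk λ { zero → lead ; (suc k) → high k }

linFactor-cancelˡ : ∀ d f g h → remainder d f ≡ 0E → f *ₚ g ≋ linFactor d *ₚ h → quotient d f *ₚ g ≋ h
linFactor-cancelˡ d f g h r e = linFactor-cancel d (f′ *ₚ g) h (begin
  linFactor d *ₚ (f′ *ₚ g)      ≈⟨ *ₚ-assoc (linFactor d) f′ g ⟨
  (linFactor d *ₚ f′) *ₚ g      ≈⟨ *ₚ-cong (exact-division d f r) (≋-refl {g}) ⟨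
  f *ₚ g                     ≈⟨ e ⟩
  linFactor d *ₚ h              ∎)
  where
  open ≈-Reasoning ℙ.setoid
  f′ = quotient d f

linFactor-cancelʳ : ∀ d f g h → remainder d g ≡ 0E → f *ₚ g ≋ linFactor d *ₚ h → f *ₚ quotient d g ≋ h
linFactor-cancelʳ d f g h s e = ≋-trans (*ₚ-comm f (quotient d g))
  (linFactor-cancelˡ d g f h s (≋-trans (*ₚ-comm g f) e))

module _ {ℓ} {P : Eis → Set ℓ} where

  Splits : ℕ → Poly → Set ℓ
  Splits n f = Σ (Vec Eis n) λ ls → VAll.All P ls × f ≋ linProd ls

  splits-∷ : ∀ {n} d f → P d → remainder d f ≡ 0E → Splits n (quotient d f) → Splits (suc n) f
  splits-∷ d f p r (ls , ps , e) = d ∷ ls , p ∷ ps , ≋-trans (exact-division d f r) (*ₚ-congʳ (linFactor d) e)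

  -- Each root d of the product is a root of f or of g and is divided out there; those taken from f
  -- form its factorisation. The list cannot run out while f has positive degree, since fg = 1 would
  -- force g = 0.
  monic-divisor-splits : ∀ n f g ds → Monic n f → All P ds → f *ₚ g ≋ linProdₗ ds → Splits n f
  monic-divisor-splits zero    f g ds       monic ps       e = [] , [] , monic₀ f monic
  monic-divisor-splits (suc n) f g []       monic ps       e =
    ⊥-elim (1≢0 (trans (sym (coeffs e 0)) (coeffs fg≋0 0)))
    where
    1≢0 : ¬ 1E ≡ 0E
    1≢0 ()
    fg≋0 : f *ₚ g ≋ []
    fg≋0 = ≋-trans (*ₚ-congʳ f (monic-cancel (suc n) f g monic (λ k → coeffs e (suc n ℕ.+ k)))) (*ₚ-zeroʳ f)
  monic-divisor-splits (suc n) f g (d ∷ ds) monic (p ∷ ps) e = Sum.[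
      (λ r → splits-∷ d f p r
        (monic-divisor-splits n (quotient d f) g ds (quotient-monic n d f monic) ps
          (linFactor-cancelˡ d f g (linProdₗ ds) r e))) ,
      (λ s → monic-divisor-splits (suc n) f (quotient d g) ds monic ps
          (linFactor-cancelʳ d f g (linProdₗ ds) s e)) ]′
    (root-of-product d f g (linProdₗ ds) e)

-- Linear maps on vectors and products of factors M - c

module Σ𝔼 = Algebra.Properties.Semiring.Sum 𝔼.semiring
module D𝔼 = Determinant eisensteinRing
open Σ𝔼 using (sum)

V : ℕ → Set
V n = Fin n → Eis

𝟎 : ∀ {n} → V n
𝟎 _ = 0E

infixr 8 _⊛_
_⊛_ : ∀ {n} → Matrix n → V n → V n
(M ⊛ v) i = sum (λ j → M i j *E v j)

_ᵀ : ∀ {n} → Matrix n → Matrix n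
(M ᵀ) i j = M j i

record Linear {n} (f : V n → V n) : Set where
  field
    resp   : ∀ {x y} → x ≗ y → f x ≗ f y
    linear : ∀ a x y i → f (λ j → (a *E x j) +E y j) i ≡ (a *E f x i) +E f y i

  f-zero : f 𝟎 ≗ 𝟎
  -- For a = -1 and both vectors zero the argument is zero again, so f 0 = -f 0 + f 0.
  f-zero i = trans (resp (λ _ → refl) i) (trans (linear (-E 1E) 𝟎 𝟎 i) (cancel (f 𝟎 i)))
    where
    cancel : ∀ x → ((-E 1E) *E x) +E x ≡ 0E
    cancel = Tactic.RingSolver.solve-∀ eisenstein-acr

  scaled : ∀ a x i → f (λ j → a *E x j) i ≡ a *E f x i
  scaled a x i = trans (resp (λ j → sym (𝔼.+-identityʳ (a *E x j))) i)
    (trans (linear a x 𝟎 i) (trans (cong ((a *E f x i) +E_) (f-zero i)) (𝔼.+-identityʳ _)))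

  combination : ∀ a b x y i → f (λ j → (a *E x j) +E (b *E y j)) i ≡ (a *E f x i) +E (b *E f y i)
  combination a b x y i = trans (linear a x (λ j → b *E y j) i) (cong ((a *E f x i) +E_) (scaled b y i))

⊛-linear : ∀ {n} (M : Matrix n) → Linear (M ⊛_)
⊛-linear M = record
  { resp   = λ e i → Σ𝔼.sum-cong-≗ (λ j → cong (M i j *E_) (e j))
  ; linear = λ a x y i → D𝔼.sum-linear a (λ j → rearrange (M i j) a (x j) (y j))
  }
  where
  rearrange : ∀ m a x y → m *E ((a *E x) +E y) ≡ (a *E (m *E x)) +E (m *E y)
  rearrange = Tactic.RingSolver.solve-∀ eisenstein-acr

-- The operator M - c, written in the shape `(a *E x) +E y` so that a linear map passes through it
-- by one use of `linear`.
step : ∀ {n} → Matrix n → Eis → V n → V n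
step M c v i = ((-E c) *E v i) +E (M ⊛ v) i

step-linear : ∀ {n} (M : Matrix n) c → Linear (step M c)
step-linear M c = record
  { resp   = λ e i → cong₂ (λ s t → ((-E c) *E s) +E t) (e i) (L.resp e i)
  ; linear = λ a x y i → trans (cong (((-E c) *E ((a *E x i) +E y i)) +E_) (L.linear a x y i))
      (rearrange c a (x i) (y i) ((M ⊛ x) i) ((M ⊛ y) i))
  }
  where
  module L = Linear (⊛-linear M)
  rearrange : ∀ c a x y p q → ((-E c) *E ((a *E x) +E y)) +E ((a *E p) +E q)
                            ≡ (a *E (((-E c) *E x) +E p)) +E (((-E c) *E y) +E q)
  rearrange = Tactic.RingSolver.solve-∀ eisenstein-acr

-- The operator ∏ (M − c), c running over the list.
kill : ∀ {n} → Matrix n → List Eis → V n → V n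
kill M []       v = v
kill M (c ∷ cs) v = kill M cs (step M c v)

kill-linear : ∀ {n} (M : Matrix n) cs → Linear (kill M cs)
kill-linear M []       = record { resp = λ e → e ; linear = λ a x y i → refl }
kill-linear M (c ∷ cs) = record
  { resp   = λ e → K.resp (S.resp e)
  ; linear = λ a x y i → trans (K.resp (S.linear a x y) i) (K.linear a (step M c x) (step M c y) i)
  }
  where
  module S = Linear (step-linear M c)
  module K = Linear (kill-linear M cs)

kill-++ : ∀ {n} (M : Matrix n) cs ds v → kill M (cs ++ ds) v ≡ kill M ds (kill M cs v)
kill-++ M []       ds v = refl
kill-++ M (c ∷ cs) ds v = kill-++ M cs ds (step M c v)

Annihilates : ∀ {n} → Matrix n → List Eis → Set
Annihilates M cs = ∀ v → kill M cs v ≗ 𝟎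

Commute : ∀ {n} → (V n → V n) → (V n → V n) → Set
Commute f g = ∀ v → f (g v) ≗ g (f v)

step-commute : ∀ {n} {g : V n → V n} (M : Matrix n) c → Linear g → Commute g (M ⊛_) → Commute g (step M c)
step-commute {g = g} M c lin comm v i = trans (Linear.linear lin (-E c) v (M ⊛ v) i)
  (cong (((-E c) *E g v i) +E_) (comm v i))

kill-commute : ∀ {n} {g : V n → V n} (M : Matrix n) cs → Linear g → Commute g (M ⊛_) → Commute g (kill M cs)
kill-commute M []       lin comm v i = refl
kill-commute M (c ∷ cs) lin comm v i = trans (kill-commute M cs lin comm (step M c v) i)
  (Linear.resp (kill-linear M cs) (step-commute M c lin comm v) i)

step-kill-commute : ∀ {n} (M : Matrix n) c cs → Commute (step M c) (kill M cs)
step-kill-commute M c cs = kill-commute M cs (step-linear M c)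
  (λ v i → sym (step-commute M c (⊛-linear M) (λ _ _ → refl) v i))

-- Annihilators of a combination of two commuting matrices

-- Every pair is listed, grouped by μ, because no matching between the two lists of roots is
-- available.
combinedRoots : Eis → Eis → List Eis → List Eis → List Eis
combinedRoots a b []       νs = []
combinedRoots a b (μ ∷ μs) νs = List.map (λ ν → (a *E μ) +E (b *E ν)) νs ++ combinedRoots a b μs νs

module _ {n} (M N C : Matrix n) (a b : Eis)
  (MN : Commute (M ⊛_) (N ⊛_))
  (C≗ : ∀ v i → (C ⊛ v) i ≡ (a *E (M ⊛ v) i) +E (b *E (N ⊛ v) i)) where

  private
    module M⊛ = Linear (⊛-linear M)

    MC : Commute (M ⊛_) (C ⊛_)
    MC v i = trans (M⊛.resp (C≗ v) i) (trans (M⊛.combination a b (M ⊛ v) (N ⊛ v) i)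
      (trans (cong (λ t → (a *E (M ⊛ M ⊛ v) i) +E (b *E t)) (MN v i)) (sym (C≗ (M ⊛ v) i))))

    module Kernel (μs : List Eis) where
      module K = Linear (kill-linear M μs)

      K : V n → Set
      K v = kill M μs v ≗ 𝟎

      K-resp : ∀ {x y} → x ≗ y → K x → K y
      K-resp e k i = trans (sym (K.resp e i)) (k i)

      K-stable : ∀ {g} → Linear g → Commute g (M ⊛_) → ∀ {v} → K v → K (g v)
      K-stable lin comm {v} k i = trans (sym (kill-commute M μs lin comm v i))
        (trans (Linear.resp lin k i) (Linear.f-zero lin i))

      K-combination : ∀ {x y} → K x → K y → K (λ i → (a *E x i) +E (b *E y i))
      K-combination {x} {y} p q i = trans (K.combination a b x y i)
        (trans (cong₂ (λ s t → (a *E s) +E (b *E t)) (p i) (q i)) (vanish a b))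
        where
        vanish : ∀ a b → (a *E 0E) +E (b *E 0E) ≡ 0E
        vanish = Tactic.RingSolver.solve-∀ eisenstein-acr

      -- Modulo the kernel of ∏ (M − μᵢ), C − (aμ + bν) acts as b (N − ν) on vectors
      -- killed by M − μ.
      inner : ∀ μ νs v → K (step M μ v) → K (kill N νs v) →
              K (kill C (List.map (λ ν → (a *E μ) +E (b *E ν)) νs) v)
      inner μ []       v p q = q
      inner μ (ν ∷ νs) v p q = inner μ νs v′
        -- The first condition persists because C - c commutes with M - μ. For the second, v′ = a(M
        -- - μ)v + b(N - ν)v, and the product over `νs` sends both summands into the kernel.
        (K-resp (step-commute M μ (step-linear C c) CM v) (K-stable (step-linear C c) CM p))
        (K-resp (λ i → sym (trans (kN.resp v′≗ i) (kN.combination a b (step M μ v) (step N ν v) i)))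
          (K-combination (K-stable (kill-linear N νs) (λ w i → sym (kill-commute N νs (⊛-linear M) MN w i)) p) q))
        where
        c = (a *E μ) +E (b *E ν)
        v′ = step C c v
        module kN = Linear (kill-linear N νs)
        CM : Commute (step C c) (M ⊛_)
        CM w i = sym (step-commute C c (⊛-linear M) MC w i)
        rearrange : ∀ a b μ ν v x y → ((-E ((a *E μ) +E (b *E ν))) *E v) +E ((a *E x) +E (b *E y))
                  ≡ (a *E (((-E μ) *E v) +E x)) +E (b *E (((-E ν) *E v) +E y))
        rearrange = Tactic.RingSolver.solve-∀ eisenstein-acr
        v′≗ : v′ ≗ (λ i → (a *E step M μ v i) +E (b *E step N ν v i))
        v′≗ i = trans (cong (((-E c) *E v i) +E_) (C≗ v i)) (rearrange a b μ ν (v i) ((M ⊛ v) i) ((N ⊛ v) i))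

  -- The block of factors belonging to μ carries the kernel of the product over `μ ∷ μs` into the
  -- kernel of the product over `μs`. Block after block, v descends to the kernel of the empty
  -- product, which is zero.
  kill-combination : ∀ μs νs → Annihilates N νs → ∀ v → kill M μs v ≗ 𝟎 → kill C (combinedRoots a b μs νs) v ≗ 𝟎
  kill-combination []       νs annN v p = p
  kill-combination (μ ∷ μs) νs annN v p i = trans
    (cong (λ w → w i) (kill-++ C (List.map (λ ν → (a *E μ) +E (b *E ν)) νs) (combinedRoots a b μs νs) v))
    (kill-combination μs νs annN _
      (inner μ νs v p (λ j → trans (K.resp (annN v) j) (K.f-zero j))) i)
    where open Kernel μs

  annihilates-combination : ∀ μs νs → Annihilates M μs → Annihilates N νs → Annihilates C (combinedRoots a b μs νs)
  annihilates-combination μs νs annM annN v = kill-combination μs νs annN v (annM v)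

-- The bilinear form and transposes

dot : ∀ {n} → V n → V n → Eis
dot x y = sum (λ i → x i *E y i)

dot-cong : ∀ {n} {x x′ y y′ : V n} → x ≗ x′ → y ≗ y′ → dot x y ≡ dot x′ y′
dot-cong e f = Σ𝔼.sum-cong-≗ (λ i → cong₂ _*E_ (e i) (f i))

dot-comm : ∀ {n} (x y : V n) → dot x y ≡ dot y x
dot-comm x y = Σ𝔼.sum-cong-≗ (λ i → 𝔼.*-comm (x i) (y i))

dot-linearʳ : ∀ {n} c (x y z : V n) → dot x (λ i → (c *E y i) +E z i) ≡ (c *E dot x y) +E dot x z
dot-linearʳ c x y z = D𝔼.sum-linear c (λ i → rearrange c (x i) (y i) (z i))
  where
  rearrange : ∀ c x y z → x *E ((c *E y) +E z) ≡ (c *E (x *E y)) +E (x *E z)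
  rearrange = Tactic.RingSolver.solve-∀ eisenstein-acr

dot-zeroʳ : ∀ {n} (x : V n) → dot x 𝟎 ≡ 0E
dot-zeroʳ {n} x = trans (Σ𝔼.sum-cong-≗ (λ i → 𝔼.zeroʳ (x i))) (Σ𝔼.sum-replicate-zero n)

dot-⊛ : ∀ {n} (M : Matrix n) x y → dot ((M ᵀ) ⊛ x) y ≡ dot x (M ⊛ y)
dot-⊛ M x y = begin
  sum (λ i → sum (λ j → M j i *E x j) *E y i)
    ≡⟨ Σ𝔼.sum-cong-≗ (λ i → Σ𝔼.*-distribʳ-sum (y i) (λ j → M j i *E x j)) ⟩
  sum (λ i → sum (λ j → (M j i *E x j) *E y i))
    ≡⟨ Σ𝔼.∑-comm (λ i j → (M j i *E x j) *E y i) ⟩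
  sum (λ j → sum (λ i → (M j i *E x j) *E y i))
    ≡⟨ Σ𝔼.sum-cong-≗ (λ j → Σ𝔼.sum-cong-≗ (λ i → rearrange (M j i) (x j) (y i))) ⟩
  sum (λ j → sum (λ i → x j *E (M j i *E y i)))
    ≡⟨ Σ𝔼.sum-cong-≗ (λ j → Σ𝔼.*-distribˡ-sum (x j) (λ i → M j i *E y i)) ⟨
  sum (λ j → x j *E sum (λ i → M j i *E y i)) ∎
  where
  open ≡.≡-Reasoning
  rearrange : ∀ m x y → (m *E x) *E y ≡ x *E (m *E y)
  rearrange = Tactic.RingSolver.solve-∀ eisenstein-acr

dot-step : ∀ {n} (M : Matrix n) c x y → dot (step (M ᵀ) c x) y ≡ dot x (step M c y)
dot-step M c x y = begin
  dot (step (M ᵀ) c x) y                          ≡⟨ dot-comm _ y ⟩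
  dot y (step (M ᵀ) c x)                          ≡⟨ dot-linearʳ (-E c) y x ((M ᵀ) ⊛ x) ⟩
  ((-E c) *E dot y x) +E dot y ((M ᵀ) ⊛ x)        ≡⟨ cong₂ (λ s t → ((-E c) *E s) +E t) (dot-comm y x)
                                                       (trans (dot-comm y ((M ᵀ) ⊛ x)) (dot-⊛ M x y)) ⟩
  ((-E c) *E dot x y) +E dot x (M ⊛ y)            ≡⟨ dot-linearʳ (-E c) x y (M ⊛ y) ⟨
  dot x (step M c y)                              ∎
  where open ≡.≡-Reasoning

dot-kill : ∀ {n} (M : Matrix n) cs x y → dot (kill (M ᵀ) cs x) y ≡ dot x (kill M cs y)
dot-kill M []       x y = refl
dot-kill M (c ∷ cs) x y = trans (dot-kill M cs (step (M ᵀ) c x) y)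
  (trans (dot-step M c x (kill M cs y)) (dot-cong {x = x} (λ _ → refl) (step-kill-commute M c cs y)))

-- Coordinate i is the pairing with a unit vector, and moving the operator across the pairing
-- replaces the transpose by M.
annihilates-transpose : ∀ {n} (M : Matrix n) cs → Annihilates M cs → Annihilates (M ᵀ) cs
annihilates-transpose M cs ann v i = begin
  kill (M ᵀ) cs v i                    ≡⟨ D𝔼.sum-unitˡ i (kill (M ᵀ) cs v) ⟨
  dot (D𝔼.unit i) (kill (M ᵀ) cs v)    ≡⟨ dot-comm (D𝔼.unit i) _ ⟩
  dot (kill (M ᵀ) cs v) (D𝔼.unit i)    ≡⟨ dot-kill M cs v (D𝔼.unit i) ⟩
  dot v (kill M cs (D𝔼.unit i))        ≡⟨ dot-cong {x = v} (λ _ → refl) (ann (D𝔼.unit i)) ⟩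
  dot v 𝟎                              ≡⟨ dot-zeroʳ v ⟩
  0E                                   ∎
  where open ≡.≡-Reasoning

-- Cancelling injective factors

Injective-at : ∀ {n} → Matrix n → Eis → Set
Injective-at M c = ∀ v → step M c v ≗ 𝟎 → v ≗ 𝟎

discard-injective : ∀ {ℓ} {Good : Eis → Set ℓ} {n} (M : Matrix n) → (∀ c → Good c ⊎ Injective-at M c) →
  ∀ cs → Σ (List Eis) λ ds → All Good ds × (∀ v → kill M cs v ≗ 𝟎 → kill M ds v ≗ 𝟎)
discard-injective M dec [] = [] , [] , λ v e → e
discard-injective M dec (c ∷ cs) with discard-injective M dec cs | dec c
... | ds , good , imp | inj₁ g   = c ∷ ds , g ∷ good , λ v e → imp (step M c v) e
... | ds , good , imp | inj₂ inj = ds , good , λ v e →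
  imp v (inj (kill M cs v) (λ i → trans (step-kill-commute M c cs v i) (e i)))

step≗0 : ∀ {n} (M : Matrix n) c v → step M c v ≗ 𝟎 → ∀ i → (M ⊛ v) i ≡ c *E v i
step≗0 M c v e i = trans (isolate c (v i) ((M ⊛ v) i))
  (trans (cong (_+E (c *E v i)) (e i)) (𝔼.+-identityˡ _))
  where
  isolate : ∀ c x y → y ≡ (((-E c) *E x) +E y) +E (c *E x)
  isolate = Tactic.RingSolver.solve-∀ eisenstein-acr

-- Conjugation and the eigenvalues of Hermitian matrices

conj : Eis → Eis
conj (a + b ω) = (a Int.- b) + (Int.- b) ω

conj-+ : ∀ x y → conj (x +E y) ≡ conj x +E conj y
conj-+ (a + b ω) (c + d ω) = cong₂ _+_ω (e₁ a b c d) (e₂ b d)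
  where
  open Int using (_+_; _-_; -_)
  e₁ : ∀ a b c d → a + c - (b + d) ≡ (a - b) + (c - d)
  e₁ = solve-∀
  e₂ : ∀ b d → - (b + d) ≡ - b + - d
  e₂ = solve-∀

conj-* : ∀ x y → conj (x *E y) ≡ conj x *E conj y
conj-* (a + b ω) (c + d ω) = cong₂ _+_ω (e₁ a b c d) (e₂ a b c d)
  where
  open Int using (_+_; _-_; -_; _*_)
  e₁ : ∀ a b c d → a * c - b * d - (a * d + b * c - b * d) ≡ (a - b) * (c - d) - (- b) * (- d)
  e₁ = solve-∀
  e₂ : ∀ a b c d → - (a * d + b * c - b * d) ≡ (a - b) * (- d) + (- b) * (c - d) - (- b) * (- d)
  e₂ = solve-∀

conj-involutive : ∀ x → conj (conj x) ≡ x
conj-involutive (a + b ω) = cong₂ _+_ω (e₁ a b) (e₂ b)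
  where
  open Int using (_-_; -_)
  e₁ : ∀ a b → a - b - - b ≡ a
  e₁ = solve-∀
  e₂ : ∀ b → - - b ≡ b
  e₂ = solve-∀

conj-sum : ∀ {n} (f : V n) → conj (sum f) ≡ sum (conj ∘ f)
conj-sum {zero}  f = refl
conj-sum {suc n} f = trans (conj-+ (f zero) _) (cong (conj (f zero) +E_) (conj-sum (f ∘ suc)))

conj-fixed⇒real : ∀ c → c +E (-E conj c) ≡ 0E → im c ≡ 0ℤ
conj-fixed⇒real (a + b ω) e with ℤₚ.i*j≡0⇒i≡0∨j≡0 (Int.+ 2) (trans (double b) (cong im e))
  where
  open Int using (_+_; -_; _*_; +_)
  double : ∀ b → + 2 * b ≡ b + - - b
  double = solve-∀
... | inj₁ ()
... | inj₂ p = p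

sumℕ : ∀ {n} → (Fin n → ℕ) → ℕ
sumℕ {zero}  f = 0
sumℕ {suc n} f = f zero ℕ.+ sumℕ (f ∘ suc)

sumℕ≡0 : ∀ {n} (f : Fin n → ℕ) → sumℕ f ≡ 0 → ∀ i → f i ≡ 0
sumℕ≡0 f e zero    = ℕₚ.m+n≡0⇒m≡0 (f zero) e
sumℕ≡0 f e (suc i) = sumℕ≡0 (f ∘ suc) (ℕₚ.m+n≡0⇒n≡0 (f zero) e) i

4E : Eis
4E = ℤ→E (Int.+ 4)

4·conj·self : ∀ x → 4E *E (conj x *E x) ≡ ℤ→E (Int.+ norm₄ x)
4·conj·self (a + b ω) = trans (cong₂ _+_ω (e₁ a b) (e₂ a b)) (cong ℤ→E (sym (norm₄-formula a b)))
  where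
  open Int using (_+_; _-_; -_; _*_; +_)
  e₁ : ∀ a b → + 4 * ((a - b) * a - (- b) * b) - 0ℤ * ((a - b) * b + (- b) * a - (- b) * b)
             ≡ + 4 * (a * a - a * b + b * b)
  e₁ = solve-∀
  e₂ : ∀ a b → + 4 * ((a - b) * b + (- b) * a - (- b) * b) + 0ℤ * ((a - b) * a - (- b) * b)
             - 0ℤ * ((a - b) * b + (- b) * a - (- b) * b) ≡ 0ℤ
  e₂ = solve-∀

4·dot-conj : ∀ {n} (v : V n) → 4E *E dot (conj ∘ v) v ≡ ℤ→E (Int.+ sumℕ (norm₄ ∘ v))
4·dot-conj {zero}  v = refl
4·dot-conj {suc n} v = begin
  4E *E ((conj (v zero) *E v zero) +E dot (conj ∘ v ∘ suc) (v ∘ suc))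
    ≡⟨ 𝔼.distribˡ 4E (conj (v zero) *E v zero) (dot (conj ∘ v ∘ suc) (v ∘ suc)) ⟩
  (4E *E (conj (v zero) *E v zero)) +E (4E *E dot (conj ∘ v ∘ suc) (v ∘ suc))
    ≡⟨ cong₂ _+E_ (4·conj·self (v zero)) (4·dot-conj (v ∘ suc)) ⟩
  ℤ→E (Int.+ norm₄ (v zero) Int.+ Int.+ sumℕ (norm₄ ∘ v ∘ suc))
    ≡⟨ cong ℤ→E (ℤₚ.pos-+ (norm₄ (v zero)) _) ⟨
  ℤ→E (Int.+ (norm₄ (v zero) ℕ.+ sumℕ (norm₄ ∘ v ∘ suc))) ∎
  where open ≡.≡-Reasoning

-- Four times the form is a sum of natural numbers `norm₄`, which vanishes only term by term.
dot-conj-definite : ∀ {n} (v : V n) → dot (conj ∘ v) v ≡ 0E → v ≗ 𝟎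
dot-conj-definite v e i = norm₄≡0⇒≡0 (v i) (sumℕ≡0 (norm₄ ∘ v)
  (ℤₚ.+-injective (cong re (trans (sym (4·dot-conj v)) (cong (4E *E_) e)))) i)

conj-dot : ∀ {n} (x y : V n) → conj (dot x y) ≡ dot (conj ∘ x) (conj ∘ y)
conj-dot x y = trans (conj-sum (λ i → x i *E y i)) (Σ𝔼.sum-cong-≗ (λ i → conj-* (x i) (y i)))

Hermitian : ∀ {n} → Matrix n → Set
Hermitian H = ∀ i j → conj (H i j) ≡ H j i

-- If Hv = cv, then c times the squared length of v is a value of the Hermitian form, hence real;
-- thus c - conj c times that length is zero. As `im` is the coefficient of ω, a real c is already
-- an integer.
hermitian-eigenvalue : ∀ {n} (H : Matrix n) → Hermitian H → ∀ c → im c ≡ 0ℤ ⊎ Injective-at H c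
hermitian-eigenvalue H herm c with im c ℤₚ.≟ 0ℤ
... | yes p = inj₁ p
... | no ¬p = inj₂ λ v e → dot-conj-definite v (Sum.[ (λ q → ⊥-elim (¬p (conj-fixed⇒real c q))) , (λ q → q) ]′
                (*E≡0⇒≡0 (c +E (-E conj c)) (dot (conj ∘ v) v) (product-zero v (step≗0 H c v e))))
  where
  open ≡.≡-Reasoning
  form-real : ∀ v → conj (dot (conj ∘ v) (H ⊛ v)) ≡ dot (conj ∘ v) (H ⊛ v)
  form-real v = begin
    conj (dot (conj ∘ v) (H ⊛ v))               ≡⟨ conj-dot (conj ∘ v) (H ⊛ v) ⟩
    dot (conj ∘ conj ∘ v) (conj ∘ (H ⊛ v))      ≡⟨ dot-cong (conj-involutive ∘ v) conj-H⊛v ⟩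
    dot v ((H ᵀ) ⊛ (conj ∘ v))                  ≡⟨ dot-comm v _ ⟩
    dot ((H ᵀ) ⊛ (conj ∘ v)) v                  ≡⟨ dot-⊛ H (conj ∘ v) v ⟩
    dot (conj ∘ v) (H ⊛ v)                      ∎
    where
    conj-H⊛v : conj ∘ (H ⊛ v) ≗ (H ᵀ) ⊛ (conj ∘ v)
    conj-H⊛v i = trans (conj-sum (λ j → H i j *E v j))
      (Σ𝔼.sum-cong-≗ (λ j → trans (conj-* (H i j) (v j)) (cong (_*E conj (v j)) (herm i j))))
  norm-real : ∀ v → conj (dot (conj ∘ v) v) ≡ dot (conj ∘ v) v
  norm-real v = trans (conj-dot (conj ∘ v) v)
    (trans (dot-cong (conj-involutive ∘ v) (λ _ → refl)) (dot-comm v (conj ∘ v)))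
  form-eigen : ∀ v → (∀ i → (H ⊛ v) i ≡ c *E v i) → dot (conj ∘ v) (H ⊛ v) ≡ c *E dot (conj ∘ v) v
  form-eigen v e = begin
    dot (conj ∘ v) (H ⊛ v)                          ≡⟨ dot-cong {x = conj ∘ v} (λ _ → refl)
                                                         (λ i → trans (e i) (sym (𝔼.+-identityʳ _))) ⟩
    dot (conj ∘ v) (λ i → (c *E v i) +E 0E)         ≡⟨ dot-linearʳ c (conj ∘ v) v 𝟎 ⟩
    (c *E dot (conj ∘ v) v) +E dot (conj ∘ v) 𝟎     ≡⟨ cong ((c *E dot (conj ∘ v) v) +E_) (dot-zeroʳ (conj ∘ v)) ⟩
    (c *E dot (conj ∘ v) v) +E 0E                   ≡⟨ 𝔼.+-identityʳ _ ⟩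
    c *E dot (conj ∘ v) v                           ∎
  difference : ∀ c d s → (c +E (-E d)) *E s ≡ (c *E s) +E (-E (d *E s))
  difference = Tactic.RingSolver.solve-∀ eisenstein-acr
  product-zero : ∀ v → (∀ i → (H ⊛ v) i ≡ c *E v i) → (c +E (-E conj c)) *E dot (conj ∘ v) v ≡ 0E
  product-zero v e = begin
    (c +E (-E conj c)) *E s                   ≡⟨ difference c (conj c) s ⟩
    (c *E s) +E (-E (conj c *E s))            ≡⟨ cong (λ t → (c *E s) +E (-E (conj c *E t))) (norm-real v) ⟨
    (c *E s) +E (-E (conj c *E conj s))       ≡⟨ cong (λ t → (c *E s) +E (-E t)) (conj-* c s) ⟨
    (c *E s) +E (-E conj (c *E s))            ≡⟨ cong (λ t → (c *E s) +E (-E conj t)) (form-eigen v e) ⟨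
    (c *E s) +E (-E conj (dot (conj ∘ v) (H ⊛ v))) ≡⟨ cong (λ t → (c *E s) +E (-E t)) (trans (form-real v) (form-eigen v e)) ⟩
    (c *E s) +E (-E (c *E s))                 ≡⟨ 𝔼.-‿inverseʳ (c *E s) ⟩
    0E                                        ∎
    where s = dot (conj ∘ v) v

-- Divisibility by the prime above 3

-- The prime above 3.
π : Eis
π = 1ℤ + Int.-[1+ 0 ] ω

norm₄-π* : ∀ x → norm₄ (π *E x) ≡ 3 ℕ.* norm₄ x
-- `norm₄ π` evaluates to 12 = 4 · 3.
norm₄-π* x = ℕₚ.*-cancelˡ-≡ (norm₄ (π *E x)) (3 ℕ.* norm₄ x) 4
  (trans (sym (norm₄-* π x)) (ℕₚ.*-assoc 4 3 (norm₄ x)))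

π*-cancel : ∀ x → π *E x ≡ 0E → x ≡ 0E
π*-cancel x e = Sum.[ (λ ()) , (λ p → p) ]′ (*E≡0⇒≡0 π x e)

-- Infinite descent: if v = πBv, then w = Bv satisfies w = πBw by linearity, and each coordinate of
-- v has three times the norm of that of w. The bound m concerns a single coordinate, while the
-- equation is kept for all of them.
π-descent : ∀ {n} (B : V n → V n) → Linear B → ∀ m v → (∀ i → v i ≡ π *E B v i) → ∀ i → norm₄ (v i) ℕ.≤ m → v i ≡ 0E
π-descent B lin zero    v e i le = norm₄≡0⇒≡0 (v i) (ℕₚ.n≤0⇒n≡0 le)
π-descent B lin (suc m) v e i le = trans (e i) (trans (cong (π *E_) w≡0) refl)
  where
  third : ∀ k → 3 ℕ.* k ℕ.≤ suc m → k ℕ.≤ m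
  third zero    _        = z≤n
  third (suc k) (s≤s le) = ℕₚ.≤-trans (ℕₚ.≤-trans (ℕₚ.m≤m+n (suc k) (suc k ℕ.+ 0)) (ℕₚ.m≤n+m _ k)) le
  w≡0 : B v i ≡ 0E
  w≡0 = π-descent B lin m (B v) (λ j → trans (Linear.resp lin e j) (Linear.scaled lin π (B v) j)) i
    (third (norm₄ (B v i)) (ℕₚ.≤-trans (ℕₚ.≤-reflexive (trans (sym (norm₄-π* (B v i))) (cong norm₄ (sym (e i))))) le))

DivisibleByπ : Eis → Set
DivisibleByπ c = ∃ λ t → c ≡ π *E t

-- Modulo π one has ω ≡ 1, so the class of a + bω is that of a + b modulo 3.
mod-π : ∀ c → DivisibleByπ c ⊎ (∃ λ t → c ≡ 1E +E (π *E t)) ⊎ (∃ λ t → c ≡ (-E 1E) +E (π *E t))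
mod-π (a + b ω) = classify ((a + b) %ℕ 3) (n%ℕd<d (a + b) 3) (a≡a%ℕn+[a/ℕn]*n (a + b) 3)
  where
  open Int using (_+_; _-_; -_; _*_; +_)
  open ℤ-DivMod using (_%ℕ_; _/ℕ_; n%ℕd<d; a≡a%ℕn+[a/ℕn]*n)
  -- π (x + yω) = (x + y) + (2y − x)ω
  witness : ℤ → Eis
  witness q = (+ 2 * q - b) + q ω
  decompose : ∀ e q → a + b ≡ e + q * + 3 → (a + b ω) ≡ ℤ→E e +E (π *E witness q)
  decompose e q p = cong₂ _+_ω
    (trans (isolate a b) (trans (cong (_- b) p) (e₁ e q b))) (e₂ q b)
    where
    isolate : ∀ a b → a ≡ a + b - b
    isolate = solve-∀
    e₁ : ∀ e q b → e + q * + 3 - b ≡ e + (1ℤ * (+ 2 * q - b) - (- 1ℤ) * q)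
    e₁ = solve-∀
    e₂ : ∀ q b → b ≡ 0ℤ + (1ℤ * q + (- 1ℤ) * (+ 2 * q - b) - (- 1ℤ) * q)
    e₂ = solve-∀
  classify : ∀ r → r ℕ.< 3 → a + b ≡ + r + ((a + b) /ℕ 3) * + 3 →
    DivisibleByπ (a + b ω) ⊎ (∃ λ t → (a + b ω) ≡ 1E +E (π *E t)) ⊎ (∃ λ t → (a + b ω) ≡ (-E 1E) +E (π *E t))
  classify 0 _ p = inj₁ (witness q , trans (decompose 0ℤ q p) (𝔼.+-identityˡ _))
    where q = (a + b) /ℕ 3
  classify 1 _ p = inj₂ (inj₁ (witness q , decompose 1ℤ q p))
    where q = (a + b) /ℕ 3
  -- Residue 2 is taken as -1, so that both nonzero classes are represented by units and an
  -- eigenvector equation can be solved for v.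
  classify 2 _ p = inj₂ (inj₂ (witness (q + 1ℤ) , decompose (- 1ℤ) (q + 1ℤ) (trans p (carry q))))
    where
    q = (a + b) /ℕ 3
    carry : ∀ q → + 2 + q * + 3 ≡ - 1ℤ + (q + 1ℤ) * + 3
    carry = solve-∀
  classify (suc (suc (suc r))) (s≤s (s≤s (s≤s ()))) p

-- If π ∤ c then c = ±1 + πt, so (πA − c) v = 0 forces v = π B v with B = ±(A − t),
-- and v is divisible by every power of π.
π-multiple-eigenvalue : ∀ {n} (A C : Matrix n) → (∀ v i → (C ⊛ v) i ≡ π *E (A ⊛ v) i) →
  ∀ c → DivisibleByπ c ⊎ Injective-at C c
π-multiple-eigenvalue A C C≗ c with mod-π c
... | inj₁ d = inj₁ d
... | inj₂ (inj₁ (t , p)) = inj₂ λ v e i →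
  π-descent (step A t) (step-linear A t) (norm₄ (v i)) v
    (λ j → trans (solve₁ t (v j) π) (trans (cong (λ s → (s *E v j) +E ((-E (π *E t)) *E v j)) (sym p))
      (trans (cong (_+E ((-E (π *E t)) *E v j)) (trans (sym (step≗0 C c v e j)) (C≗ v j)))
        (collect₁ π t (v j) ((A ⊛ v) j))))) i ℕₚ.≤-refl
  where
  solve₁ : ∀ t x π → x ≡ ((1E +E (π *E t)) *E x) +E ((-E (π *E t)) *E x)
  solve₁ = Tactic.RingSolver.solve-∀ eisenstein-acr
  collect₁ : ∀ π t x y → (π *E y) +E ((-E (π *E t)) *E x) ≡ π *E (((-E t) *E x) +E y)
  collect₁ = Tactic.RingSolver.solve-∀ eisenstein-acr
... | inj₂ (inj₂ (t , p)) = inj₂ λ v e i →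
  π-descent (λ w j → (-E 1E) *E step A t w j) negated (norm₄ (v i)) v
    (λ j → trans (solve₂ t (v j) π) (trans (cong (λ s → (-E (s *E v j)) +E ((π *E t) *E v j)) (sym p))
      (trans (cong (λ s → (-E s) +E ((π *E t) *E v j)) (trans (sym (step≗0 C c v e j)) (C≗ v j)))
        (collect₂ π t (v j) ((A ⊛ v) j))))) i ℕₚ.≤-refl
  where
  solve₂ : ∀ t x π → x ≡ (-E (((-E 1E) +E (π *E t)) *E x)) +E ((π *E t) *E x)
  solve₂ = Tactic.RingSolver.solve-∀ eisenstein-acr
  collect₂ : ∀ π t x y → (-E (π *E y)) +E ((π *E t) *E x) ≡ π *E ((-E 1E) *E (((-E t) *E x) +E y))
  collect₂ = Tactic.RingSolver.solve-∀ eisenstein-acr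
  neg-linear : ∀ a x y → (-E 1E) *E ((a *E x) +E y) ≡ (a *E ((-E 1E) *E x)) +E ((-E 1E) *E y)
  neg-linear = Tactic.RingSolver.solve-∀ eisenstein-acr
  negated : Linear (λ w j → (-E 1E) *E step A t w j)
  negated = record
    { resp   = λ e j → cong ((-E 1E) *E_) (Linear.resp (step-linear A t) e j)
    ; linear = λ a x y j → trans (cong ((-E 1E) *E_) (Linear.linear (step-linear A t) a x y j))
                 (neg-linear a (step A t x j) (step A t y j))
    }

-- Since πA - πt = π(A - t), each factor leaves a scalar π in front, which cancels in a domain.
divide-roots-by-π : ∀ {n} (A C : Matrix n) → (∀ v i → (C ⊛ v) i ≡ π *E (A ⊛ v) i) →
  ∀ {ds} → All DivisibleByπ ds → Σ (List Eis) λ ts → ∀ v → kill C ds v ≗ 𝟎 → kill A ts v ≗ 𝟎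
divide-roots-by-π A C C≗ [] = [] , λ v e → e
divide-roots-by-π A C C≗ {d ∷ ds} ((t , p) ∷ ps) with divide-roots-by-π A C C≗ ps
... | ts , imp = t ∷ ts , λ v e i → π*-cancel _ (trans
  (sym (trans (K.resp (step-C v) i) (K.scaled π (step A t v) i))) (imp (step C d v) e i))
  where
  module K = Linear (kill-linear A ts)
  collect : ∀ π t x y → ((-E (π *E t)) *E x) +E (π *E y) ≡ π *E (((-E t) *E x) +E y)
  collect = Tactic.RingSolver.solve-∀ eisenstein-acr
  step-C : ∀ v → step C d v ≗ (λ j → π *E step A t v j)
  step-C v j = trans (cong₂ (λ s u → ((-E s) *E v j) +E u) p (C≗ v j)) (collect π t (v j) ((A ⊛ v) j))

-- Characteristic polynomials and the Cayley-Hamilton theorem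

module Σℙ = Algebra.Properties.Semiring.Sum ℙ.semiring
module Dℙ = Determinant polyRing

sumₚ : ∀ {n} → (Fin n → Poly) → Poly
sumₚ = Σℙ.sum

coeff-sum : ∀ k {n} (f : Fin n → Poly) → coeff k (sumₚ f) ≡ sum (coeff k ∘ f)
coeff-sum k {zero}  f = refl
coeff-sum k {suc n} f = trans (coeff-+ k (f zero) (sumₚ (f ∘ suc))) (cong (coeff k (f zero) +E_) (coeff-sum k (f ∘ suc)))

altSum≋ : ∀ {m} {f g : Fin m → Poly} → (∀ j → f j ≋ g j) → altSum f ≋ Dℙ.altSum g
altSum≋ {zero}  e = ≋-refl
altSum≋ {suc m} e = +ₚ-cong (e zero) (-ₚ-cong (altSum≋ (e ∘ suc)))

det≋ : ∀ n M → det n M ≋ Dℙ.det n M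
det≋ zero    M = ≋-refl
det≋ (suc n) M = altSum≋ (λ j → *ₚ-congʳ (M zero j) (det≋ n (λ i k → M (suc i) (punchIn j k))))

-- The entry of X·I − M; it reduces to a list of two coefficients.
charEntry : ∀ {n} → Matrix n → Fin n → Fin n → Poly
charEntry M i j = (constₚ (δ i j) *ₚ Xₚ) -ₚ constₚ (M i j)

altSum-degree : ∀ d {m} (f : Fin m → Poly) → (∀ j → DegreeBelow d (f j)) → DegreeBelow d (altSum f)
altSum-degree d {zero}  f e k = refl
altSum-degree d {suc m} f e k = trans (coeff-+ (d ℕ.+ k) (f zero) (-ₚ altSum (f ∘ suc)))
  (cong₂ _+E_ (e zero k) (trans (coeff-neg (d ℕ.+ k) (altSum (f ∘ suc)))
    (cong -E_ (altSum-degree d (f ∘ suc) (e ∘ suc) k))))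

degreeBelow-suc : ∀ {d p} → DegreeBelow d p → DegreeBelow (suc d) p
degreeBelow-suc {d} {p} e k = trans (cong (λ i → coeff i p) (sym (ℕₚ.+-suc d k))) (e (suc k))

binomial-degree : ∀ d a b p → DegreeBelow d p → DegreeBelow (suc d) ((a ∷ b ∷ []) *ₚ p)
binomial-degree d a b p e k = trans (coeff-binomial (d ℕ.+ k) a b p)
  (trans (cong₂ (λ x y → (a *E x) +E (b *E y)) (degreeBelow-suc {d} {p} e k) (e k)) (vanish a b))
  where
  vanish : ∀ a b → (a *E 0E) +E (b *E 0E) ≡ 0E
  vanish = Tactic.RingSolver.solve-∀ eisenstein-acr

-- Arbitrary entries of degree at most 1 are allowed because the minors met along the expansion no
-- longer have the form X·I - M.
det-degree : ∀ n (A B : Matrix n) → DegreeBelow (suc n) (det n (λ i j → A i j ∷ B i j ∷ []))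
det-degree zero    A B k = refl
det-degree (suc n) A B = altSum-degree (suc (suc n)) (λ j → (A zero j ∷ B zero j ∷ []) *ₚ D j) λ j →
  binomial-degree (suc n) (A zero j) (B zero j) (D j)
    (det-degree n (λ i k → A (suc i) (punchIn j k)) (λ i k → B (suc i) (punchIn j k)))
  where
  D : Fin (suc n) → Poly
  D j = det n (λ i k → A (suc i) (punchIn j k) ∷ B (suc i) (punchIn j k) ∷ [])

-- Off the diagonal the first row is constant, so only the corner term reaches degree n + 1. The
-- minor of that corner is again a characteristic polynomial, monic by induction.
charPoly-monic : ∀ n M → Monic n (charPoly n M)
charPoly-monic zero    M = refl , λ k → refl
charPoly-monic (suc n) M = lead , det-degree (suc n)
    (λ i j → (((δ i j) *E 0E) +E 0E) +E (-E M i j)) (λ i j → (δ i j) *E 1E)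
  where
  open ≡.≡-Reasoning
  a₀ : Fin (suc n) → Eis
  a₀ j = ((δ zero j *E 0E) +E 0E) +E (-E M zero j)
  D : Fin (suc n) → Poly
  D j = det n (λ i k → charEntry M (suc i) (punchIn j k))
  D-degree : ∀ j → DegreeBelow (suc n) (D j)
  D-degree j = det-degree n
    (λ i k → ((δ (suc i) (punchIn j k) *E 0E) +E 0E) +E (-E M (suc i) (punchIn j k)))
    (λ i k → δ (suc i) (punchIn j k) *E 1E)
  others : Poly
  others = altSum (λ j → charEntry M zero (suc j) *ₚ D (suc j))
  first : Poly
  first = charEntry M zero zero *ₚ D zero
  const-degree : ∀ d a p → DegreeBelow d p → DegreeBelow d ((a ∷ 0E ∷ []) *ₚ p)
  const-degree d a p e k = trans (coeffs zero-lead (d ℕ.+ k)) (trans (coeff-scale (d ℕ.+ k) a p)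
      (trans (cong (a *E_) (e k)) (𝔼.zeroʳ a)))
    where
    zero-lead : (a ∷ 0E ∷ []) *ₚ p ≋ scaleₚ a p
    zero-lead = ≋-trans (+ₚ-cong (≋-refl {scaleₚ a p}) (≋-trans (∷-cong {0E} refl
      (≋-trans (+ₚ-cong (scale-zero p) shift-[]) ≋-refl)) shift-[])) (+ₚ-identityʳ (scaleₚ a p))
  others-degree : DegreeBelow (suc n) others
  others-degree = altSum-degree (suc n) (λ j → charEntry M zero (suc j) *ₚ D (suc j))
    (λ j → const-degree (suc n) (a₀ (suc j)) (D (suc j)) (D-degree (suc j)))
  at : ∀ p → DegreeBelow (suc n) p → coeff (suc n) p ≡ 0E
  at p e = trans (cong (λ i → coeff i p) (sym (ℕₚ.+-identityʳ (suc n)))) (e 0)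
  finish : ∀ a → ((a *E 0E) +E (1E *E 1E)) +E (-E 0E) ≡ 1E
  finish = Tactic.RingSolver.solve-∀ eisenstein-acr
  lead : coeff (suc n) (charPoly (suc n) M) ≡ 1E
  lead = begin
    coeff (suc n) (first -ₚ others)
      ≡⟨ coeff-+ (suc n) first (-ₚ others) ⟩
    coeff (suc n) first +E coeff (suc n) (-ₚ others)
      ≡⟨ cong₂ _+E_ (coeff-binomial n (a₀ zero) 1E (D zero)) (coeff-neg (suc n) others) ⟩
    ((a₀ zero *E coeff (suc n) (D zero)) +E (1E *E coeff n (D zero))) +E (-E coeff (suc n) others)
      ≡⟨ cong₂ (λ x y → x +E (-E y))
           (cong₂ (λ x y → (a₀ zero *E x) +E (1E *E y)) (at (D zero) (D-degree zero))
             (proj₁ (charPoly-monic n (λ i j → M (suc i) (suc j)))))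
           (at others others-degree) ⟩
    ((a₀ zero *E 0E) +E (1E *E 1E)) +E (-E 0E)
      ≡⟨ finish (a₀ zero) ⟩
    1E ∎

sum-δ : ∀ {n} (i : Fin n) (f : V n) → sum (λ j → δ i j *E f j) ≡ f i
sum-δ i f = trans (Σ𝔼.sum-cong-≗ (λ j → cong (_*E f j) (δ≡unit i j))) (D𝔼.sum-unitˡ i f)
  where
  δ≡unit : ∀ {n} (i j : Fin n) → δ i j ≡ D𝔼.unit i j
  δ≡unit zero    zero    = refl
  δ≡unit zero    (suc j) = refl
  δ≡unit (suc i) zero    = refl
  δ≡unit (suc i) (suc j) = δ≡unit i j

-- X·I - M acting on polynomials with vector coefficients: it shifts the coefficient vectors by one
-- and subtracts their images under M.
_⊗_ : ∀ {n} → Matrix n → (Fin n → Poly) → Fin n → Poly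
(M ⊗ r) i = sumₚ (λ j → charEntry M i j *ₚ r j)

coeff₀-⊗ : ∀ {n} (M : Matrix n) r i → coeff 0 ((M ⊗ r) i) ≡ -E (M ⊛ (coeff 0 ∘ r)) i
coeff₀-⊗ M r i = begin
  coeff 0 ((M ⊗ r) i)
    ≡⟨ coeff-sum 0 (λ j → charEntry M i j *ₚ r j) ⟩
  sum (λ j → coeff 0 (charEntry M i j *ₚ r j))
    ≡⟨ Σ𝔼.sum-cong-≗ (λ j → trans (coeff₀-binomial (((δ i j *E 0E) +E 0E) +E (-E M i j)) (δ i j *E 1E) (r j))
         (simplify (δ i j) (M i j) (coeff 0 (r j)))) ⟩
  sum (λ j → -E (M i j *E coeff 0 (r j)))
    ≡⟨ D𝔼.sum-neg (λ j → M i j *E coeff 0 (r j)) ⟩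
  -E (M ⊛ (coeff 0 ∘ r)) i ∎
  where
  open ≡.≡-Reasoning
  simplify : ∀ d m x → (((d *E 0E) +E 0E) +E (-E m)) *E x ≡ -E (m *E x)
  simplify = Tactic.RingSolver.solve-∀ eisenstein-acr

coeff-⊗ : ∀ {n} (M : Matrix n) r i k →
  coeff (suc k) ((M ⊗ r) i) ≡ (-E (M ⊛ (coeff (suc k) ∘ r)) i) +E coeff k (r i)
coeff-⊗ M r i k = begin
  coeff (suc k) ((M ⊗ r) i)
    ≡⟨ coeff-sum (suc k) (λ j → charEntry M i j *ₚ r j) ⟩
  sum (λ j → coeff (suc k) (charEntry M i j *ₚ r j))
    ≡⟨ Σ𝔼.sum-cong-≗ (λ j → trans (coeff-binomial k (((δ i j *E 0E) +E 0E) +E (-E M i j)) (δ i j *E 1E) (r j))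
         (simplify (δ i j) (M i j) (coeff (suc k) (r j)) (coeff k (r j)))) ⟩
  sum (λ j → (-E (M i j *E coeff (suc k) (r j))) +E (δ i j *E coeff k (r j)))
    ≡⟨ Σ𝔼.∑-distrib-+ (λ j → -E (M i j *E coeff (suc k) (r j))) (λ j → δ i j *E coeff k (r j)) ⟩
  sum (λ j → -E (M i j *E coeff (suc k) (r j))) +E sum (λ j → δ i j *E coeff k (r j))
    ≡⟨ cong₂ _+E_ (D𝔼.sum-neg (λ j → M i j *E coeff (suc k) (r j))) (sum-δ i (λ j → coeff k (r j))) ⟩
  (-E (M ⊛ (coeff (suc k) ∘ r)) i) +E coeff k (r i) ∎
  where
  open ≡.≡-Reasoning
  simplify : ∀ d m x y → ((((d *E 0E) +E 0E) +E (-E m)) *E x) +E ((d *E 1E) *E y) ≡ (-E (m *E x)) +E (d *E y)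
  simplify = Tactic.RingSolver.solve-∀ eisenstein-acr

⊗-linear : ∀ {n} (M : Matrix n) p r s i → (M ⊗ (λ j → (p *ₚ r j) +ₚ s j)) i ≋ (p *ₚ (M ⊗ r) i) +ₚ (M ⊗ s) i
⊗-linear M p r s i = Dℙ.sum-linear p (λ j → rearrange (charEntry M i j) p (r j) (s j))
  where
  rearrange : ∀ m p r s → m *ₚ ((p *ₚ r) +ₚ s) ≋ (p *ₚ (m *ₚ r)) +ₚ (m *ₚ s)
  rearrange = Tactic.RingSolver.solve-∀ polyRing-acr

common-degree-bound : ∀ {n} (r : Fin n → Poly) → ∃ λ d → ∀ j → DegreeBelow d (r j)
common-degree-bound {zero}  r = 0 , λ ()
common-degree-bound {suc n} r with common-degree-bound (r ∘ suc)
... | d , e = List.length (r zero) ℕ.+ d , λ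
  { zero k → trans (cong (λ i → coeff i (r zero)) (ℕₚ.+-assoc (List.length (r zero)) d k)) (beyond (r zero) (d ℕ.+ k))
  ; (suc j) k → trans (cong (λ i → coeff i (r (suc j))) (reorder (List.length (r zero)) d k)) (e j (List.length (r zero) ℕ.+ k))
  }
  where
  beyond : ∀ p k → coeff (List.length p ℕ.+ k) p ≡ 0E
  beyond []      k = refl
  beyond (a ∷ p) k = beyond p k
  reorder : ∀ l d k → (l ℕ.+ d) ℕ.+ k ≡ d ℕ.+ (l ℕ.+ k)
  reorder l d k = trans (cong (ℕ._+ k) (ℕₚ.+-comm l d)) (ℕₚ.+-assoc d l k)

-- X r = M r + w, so each coefficient vector of r is M times the next one, and these vanish
-- eventually.
constant-image-zero : ∀ {n} (M : Matrix n) r (w : V n) → (∀ i → (M ⊗ r) i ≋ constₚ (w i)) → w ≗ 𝟎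
constant-image-zero M r w e i = begin
  w i                              ≡⟨ coeffs (e i) 0 ⟨
  coeff 0 ((M ⊗ r) i)              ≡⟨ coeff₀-⊗ M r i ⟩
  -E (M ⊛ (coeff 0 ∘ r)) i         ≡⟨ cong -E_ (trans (L.resp (λ j → all-zero (proj₁ bound) (proj₂ bound) j 0) i) (L.f-zero i)) ⟩
  0E                               ∎
  where
  open ≡.≡-Reasoning
  module L = Linear (⊛-linear M)
  bound = common-degree-bound r
  isolate : ∀ x y → y ≡ ((-E x) +E y) +E x
  isolate = Tactic.RingSolver.solve-∀ eisenstein-acr
  descend : ∀ d → (∀ j → DegreeBelow (suc d) (r j)) → ∀ j → DegreeBelow d (r j)
  descend d z j (suc k) = trans (cong (λ i → coeff i (r j)) (ℕₚ.+-suc d k)) (z j k)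
  descend d z j zero    = trans (cong (λ i → coeff i (r j)) (ℕₚ.+-identityʳ d)) (begin
    coeff d (r j)
      ≡⟨ isolate ((M ⊛ (coeff (suc d) ∘ r)) j) (coeff d (r j)) ⟩
    ((-E (M ⊛ (coeff (suc d) ∘ r)) j) +E coeff d (r j)) +E (M ⊛ (coeff (suc d) ∘ r)) j
      ≡⟨ cong₂ _+E_ (sym (coeff-⊗ M r j d))
           (trans (L.resp (λ h → trans (cong (λ i → coeff i (r h)) (sym (ℕₚ.+-identityʳ (suc d)))) (z h 0)) j) (L.f-zero j)) ⟩
    coeff (suc d) ((M ⊗ r) j) +E 0E
      ≡⟨ cong (_+E 0E) (coeffs (e j) (suc d)) ⟩
    0E ∎)
  all-zero : ∀ d → (∀ j → DegreeBelow d (r j)) → ∀ j k → coeff k (r j) ≡ 0E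
  all-zero zero    z = z
  all-zero (suc d) z = all-zero d (descend d z)

-- This is (X - c)v = (X - M)v + (M - c)v for a constant vector v.
linFactor-const : ∀ {n} (M : Matrix n) c v i →
  linFactor c *ₚ constₚ (v i) ≋ (M ⊗ (constₚ ∘ v)) i +ₚ constₚ (step M c v i)
linFactor-const M c v i = mk λ k → trans (pointwise k)
    (sym (coeff-+ k ((M ⊗ (constₚ ∘ v)) i) (constₚ (step M c v i))))
  where
  module L = Linear (⊛-linear M)
  e₀ : ∀ c x y → (0E +E (-E c)) *E x ≡ (-E y) +E (((-E c) *E x) +E y)
  e₀ = Tactic.RingSolver.solve-∀ eisenstein-acr
  e₁ : ∀ c x y → y ≡ 0E → ((0E +E (-E c)) *E 0E) +E (1E *E x) ≡ ((-E y) +E x) +E 0E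
  e₁ c x .0E refl = lemma c x
    where
    lemma : ∀ c x → ((0E +E (-E c)) *E 0E) +E (1E *E x) ≡ ((-E 0E) +E x) +E 0E
    lemma = Tactic.RingSolver.solve-∀ eisenstein-acr
  pointwise : ∀ k → coeff k (linFactor c *ₚ constₚ (v i)) ≡ coeff k ((M ⊗ (constₚ ∘ v)) i) +E coeff k (constₚ (step M c v i))
  pointwise zero = trans (coeff₀-binomial (0E +E (-E c)) 1E (constₚ (v i)))
    (trans (e₀ c (v i) ((M ⊛ v) i)) (cong (_+E step M c v i) (sym (coeff₀-⊗ M (constₚ ∘ v) i))))
  pointwise (suc zero) = trans (coeff-binomial 0 (0E +E (-E c)) 1E (constₚ (v i)))
    (trans (e₁ c (v i) _ (L.f-zero i)) (cong (_+E 0E) (sym (coeff-⊗ M (constₚ ∘ v) i 0))))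
  pointwise (suc (suc k)) = trans (coeff-binomial (suc k) (0E +E (-E c)) 1E (constₚ (v i)))
    (trans (e₁ c 0E _ (L.f-zero i)) (cong (_+E 0E) (sym (coeff-⊗ M (constₚ ∘ v) i (suc k)))))

-- Division of p(X)v by X·I - M leaves the remainder p(M)v. The quotient is built one linear factor
-- at a time.
telescope : ∀ {n} (M : Matrix n) cs v → Σ (Fin n → Poly) λ q →
  ∀ i → linProdₗ cs *ₚ constₚ (v i) ≋ (M ⊗ q) i +ₚ constₚ (kill M cs v i)
telescope {n} M [] v = (λ _ → []) , λ i → ≋-trans (*ₚ-identityˡ (constₚ (v i)))
  (≋-sym (+ₚ-cong (≋-trans (Σℙ.sum-cong-≋ {n} (λ j → *ₚ-zeroʳ (charEntry M i j))) (Σℙ.sum-replicate-zero n)) (≋-refl {constₚ (v i)})))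
telescope M (c ∷ cs) v with telescope M cs (step M c v)
... | q , e = (λ j → (P *ₚ constₚ (v j)) +ₚ q j) , λ i → begin
  (linFactor c *ₚ P) *ₚ constₚ (v i)
    ≈⟨ rotate (linFactor c) P (constₚ (v i)) ⟩
  P *ₚ (linFactor c *ₚ constₚ (v i))
    ≈⟨ *ₚ-congʳ P (linFactor-const M c v i) ⟩
  P *ₚ ((M ⊗ (constₚ ∘ v)) i +ₚ constₚ (step M c v i))
    ≈⟨ *ₚ-distribˡ P ((M ⊗ (constₚ ∘ v)) i) (constₚ (step M c v i)) ⟩
  (P *ₚ (M ⊗ (constₚ ∘ v)) i) +ₚ (P *ₚ constₚ (step M c v i))
    ≈⟨ +ₚ-cong (≋-refl {P *ₚ (M ⊗ (constₚ ∘ v)) i}) (e i) ⟩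
  (P *ₚ (M ⊗ (constₚ ∘ v)) i) +ₚ ((M ⊗ q) i +ₚ constₚ (kill M cs (step M c v) i))
    ≈⟨ +ₚ-assoc (P *ₚ (M ⊗ (constₚ ∘ v)) i) ((M ⊗ q) i) (constₚ (kill M cs (step M c v) i)) ⟨
  ((P *ₚ (M ⊗ (constₚ ∘ v)) i) +ₚ (M ⊗ q) i) +ₚ constₚ (kill M cs (step M c v) i)
    ≈⟨ +ₚ-cong (⊗-linear M P (constₚ ∘ v) q i) (≋-refl {constₚ (kill M cs (step M c v) i)}) ⟨
  (M ⊗ (λ j → (P *ₚ constₚ (v j)) +ₚ q j)) i +ₚ constₚ (kill M cs (step M c v) i) ∎
  where
  open ≈-Reasoning ℙ.setoid
  P = linProdₗ cs
  rotate : ∀ l p x → (l *ₚ p) *ₚ x ≋ p *ₚ (l *ₚ x)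
  rotate = Tactic.RingSolver.solve-∀ polyRing-acr

-- For the characteristic polynomial p, the vector p(X)v equals (X·I - M) applied to adj(X·I - M)v,
-- and by `telescope` also (X·I - M)q + p(M)v. Hence the constant vector p(M)v lies in the image of
-- X·I - M and is zero by `constant-image-zero`.
cayley-hamilton : ∀ {n} (M : Matrix n) cs → charPoly n M ≋ linProdₗ cs → Annihilates M cs
cayley-hamilton {n} M cs f≋ v = constant-image-zero M r (kill M cs v) image
  where
  open ≈-Reasoning ℙ.setoid
  X-M : Fin n → Fin n → Poly
  X-M = charEntry M
  f = Dℙ.det n X-M
  q = proj₁ (telescope M cs v)
  s : Fin n → Poly
  s j = sumₚ (λ k → Dℙ.adj X-M j k *ₚ constₚ (v k))
  -- The difference s - q, written as a multiple of q plus s so that `⊗-linear` applies.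
  r : Fin n → Poly
  r j = ((-ₚ oneₚ) *ₚ q j) +ₚ s j
  ⊗-s : ∀ i → (M ⊗ s) i ≋ f *ₚ constₚ (v i)
  ⊗-s i = begin
    sumₚ (λ j → X-M i j *ₚ s j)
      ≈⟨ Σℙ.sum-cong-≋ {n} (λ j → Σℙ.*-distribˡ-sum (X-M i j) (λ k → Dℙ.adj X-M j k *ₚ constₚ (v k))) ⟩
    sumₚ (λ j → sumₚ (λ k → X-M i j *ₚ (Dℙ.adj X-M j k *ₚ constₚ (v k))))
      ≈⟨ Σℙ.∑-comm (λ j k → X-M i j *ₚ (Dℙ.adj X-M j k *ₚ constₚ (v k))) ⟩
    sumₚ (λ k → sumₚ (λ j → X-M i j *ₚ (Dℙ.adj X-M j k *ₚ constₚ (v k))))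
      ≈⟨ Σℙ.sum-cong-≋ {n} (λ k → Σℙ.sum-cong-≋ {n} (λ j → *ₚ-assoc (X-M i j) (Dℙ.adj X-M j k) (constₚ (v k)))) ⟨
    sumₚ (λ k → sumₚ (λ j → (X-M i j *ₚ Dℙ.adj X-M j k) *ₚ constₚ (v k)))
      ≈⟨ Σℙ.sum-cong-≋ {n} (λ k → Σℙ.*-distribʳ-sum (constₚ (v k)) (λ j → X-M i j *ₚ Dℙ.adj X-M j k)) ⟨
    sumₚ (λ k → sumₚ (λ j → X-M i j *ₚ Dℙ.adj X-M j k) *ₚ constₚ (v k))
      ≈⟨ Σℙ.sum-cong-≋ {n} (λ k → ≋-trans (*ₚ-cong (Dℙ.·-adj X-M i k) (≋-refl {constₚ (v k)}))
           (*ₚ-assoc (Dℙ.unit i k) f (constₚ (v k)))) ⟩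
    sumₚ (λ k → Dℙ.unit i k *ₚ (f *ₚ constₚ (v k)))
      ≈⟨ Dℙ.sum-unitˡ i (λ k → f *ₚ constₚ (v k)) ⟩
    f *ₚ constₚ (v i) ∎
  image : ∀ i → (M ⊗ r) i ≋ constₚ (kill M cs v i)
  image i = begin
    (M ⊗ r) i
      ≈⟨ ⊗-linear M (-ₚ oneₚ) q s i ⟩
    ((-ₚ oneₚ) *ₚ (M ⊗ q) i) +ₚ (M ⊗ s) i
      ≈⟨ +ₚ-cong (ℙₚ.-1*x≈-x ((M ⊗ q) i)) (≋-trans (⊗-s i)
           (*ₚ-cong (≋-trans (≋-sym (det≋ n X-M)) f≋) (≋-refl {constₚ (v i)}))) ⟩
    (-ₚ (M ⊗ q) i) +ₚ (linProdₗ cs *ₚ constₚ (v i))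
      ≈⟨ +ₚ-cong (≋-refl { -ₚ (M ⊗ q) i}) (proj₂ (telescope M cs v) i) ⟩
    (-ₚ (M ⊗ q) i) +ₚ ((M ⊗ q) i +ₚ constₚ (kill M cs v i))
      ≈⟨ ℙₚ.\\-leftDividesʳ ((M ⊗ q) i) (constₚ (kill M cs v i)) ⟩
    constₚ (kill M cs v i) ∎

-- Splitting the characteristic polynomial of an annihilated matrix

linProdₗ-++ : ∀ cs ds → linProdₗ (cs ++ ds) ≋ linProdₗ cs *ₚ linProdₗ ds
linProdₗ-++ []       ds = ≋-sym (*ₚ-identityˡ (linProdₗ ds))
linProdₗ-++ (c ∷ cs) ds = ≋-trans (*ₚ-congʳ (linFactor c) (linProdₗ-++ cs ds))
  (≋-sym (*ₚ-assoc (linFactor c) (linProdₗ cs) (linProdₗ ds)))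

repeat : ℕ → List Eis → List Eis
repeat zero    cs = []
repeat (suc n) cs = cs ++ repeat n cs

det-scalar : ∀ n cs → Dℙ.det n (λ i k → linProdₗ cs *ₚ Dℙ.unit i k) ≋ linProdₗ (repeat n cs)
det-scalar zero    cs = ≋-refl
det-scalar (suc n) cs = begin
  Dℙ.det (suc n) (λ i k → P *ₚ Dℙ.unit i k)
    ≈⟨ Dℙ.det-scalar-suc n P ⟩
  P *ₚ Dℙ.det n (λ i k → P *ₚ Dℙ.unit i k)
    ≈⟨ *ₚ-congʳ P (det-scalar n cs) ⟩
  P *ₚ linProdₗ (repeat n cs)
    ≈⟨ linProdₗ-++ cs (repeat n cs) ⟨
  linProdₗ (cs ++ repeat n cs) ∎
  where
  open ≈-Reasoning ℙ.setoid
  P = linProdₗ cs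

const-unit : ∀ {n} (i k : Fin n) → constₚ (D𝔼.unit k i) ≋ Dℙ.unit i k
const-unit zero    zero    = ≋-refl
const-unit zero    (suc k) = shift-[]
const-unit (suc i) zero    = shift-[]
const-unit (suc i) (suc k) = const-unit i k

annihilated⇒splits : ∀ {ℓ} {P : Eis → Set ℓ} {n} (M : Matrix n) cs → All P cs → Annihilates M cs →
                     Splits {P = P} n (charPoly n M)
annihilated⇒splits {n = n} M cs ps ann = monic-divisor-splits n (charPoly n M) (Dℙ.det n Q) (repeat n cs)
    (charPoly-monic n M) (repeat-All n) (begin
  charPoly n M *ₚ Dℙ.det n Q
    ≈⟨ *ₚ-cong (det≋ n (charEntry M)) (≋-refl {Dℙ.det n Q}) ⟩
  Dℙ.det n (charEntry M) *ₚ Dℙ.det n Q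
    ≈⟨ Dℙ.det-· n (charEntry M) Q ⟨
  Dℙ.det n (charEntry M Dℙ.· Q)
    ≈⟨ Dℙ.det-cong n product ⟩
  Dℙ.det n (λ i k → linProdₗ cs *ₚ Dℙ.unit i k)
    ≈⟨ det-scalar n cs ⟩
  linProdₗ (repeat n cs) ∎)
  where
  open ≈-Reasoning ℙ.setoid
  Q : Fin n → Fin n → Poly
  -- Column k is the quotient of p times the k-th unit vector by X·I - M; annihilation makes the
  -- division exact.
  Q j k = proj₁ (telescope M cs (D𝔼.unit k)) j
  repeat-All : ∀ m → All _ (repeat m cs)
  repeat-All zero    = []
  repeat-All (suc m) = Allₚ.++⁺ ps (repeat-All m)
  product : ∀ i k → (charEntry M Dℙ.· Q) i k ≋ linProdₗ cs *ₚ Dℙ.unit i k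
  product i k = begin
    (M ⊗ (λ j → Q j k)) i
      ≈⟨ +ₚ-identityʳ ((M ⊗ (λ j → Q j k)) i) ⟨
    (M ⊗ (λ j → Q j k)) i +ₚ []
      ≈⟨ +ₚ-cong (≋-refl {(M ⊗ (λ j → Q j k)) i}) (constₚ-zero (ann (D𝔼.unit k) i)) ⟨
    (M ⊗ (λ j → Q j k)) i +ₚ constₚ (kill M cs (D𝔼.unit k) i)
      ≈⟨ proj₂ (telescope M cs (D𝔼.unit k)) i ⟨
    linProdₗ cs *ₚ constₚ (D𝔼.unit k i)
      ≈⟨ *ₚ-congʳ (linProdₗ cs) (const-unit i k) ⟩
    linProdₗ cs *ₚ Dℙ.unit i k ∎

-- Normal matrices and combinations with the transpose

-- Normality is taken with respect to the plain transpose, without conjugation, because A and H are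
-- linked through transposes.
normal⇒commute : ∀ {n} (M : Matrix n) → (∀ i j → sum (λ k → M i k *E M j k) ≡ sum (λ k → M k i *E M k j)) →
                 Commute (M ⊛_) ((M ᵀ) ⊛_)
normal⇒commute M normal v i = begin
  sum (λ k → M i k *E sum (λ j → M j k *E v j))       ≡⟨ expand (λ k → M i k) (λ k j → M j k) ⟩
  sum (λ j → sum (λ k → M i k *E M j k) *E v j)       ≡⟨ Σ𝔼.sum-cong-≗ (λ j → cong (_*E v j) (normal i j)) ⟩
  sum (λ j → sum (λ k → M k i *E M k j) *E v j)       ≡⟨ expand (λ k → M k i) (λ k j → M k j) ⟨
  sum (λ k → M k i *E sum (λ j → M k j *E v j))       ∎
  where
  open ≡.≡-Reasoning
  expand : ∀ x (N : Matrix _) → sum (λ k → x k *E sum (λ j → N k j *E v j)) ≡ sum (λ j → sum (λ k → x k *E N k j) *E v j)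
  expand x N = begin
    sum (λ k → x k *E sum (λ j → N k j *E v j))
      ≡⟨ Σ𝔼.sum-cong-≗ (λ k → Σ𝔼.*-distribˡ-sum (x k) (λ j → N k j *E v j)) ⟩
    sum (λ k → sum (λ j → x k *E (N k j *E v j)))
      ≡⟨ Σ𝔼.∑-comm (λ k j → x k *E (N k j *E v j)) ⟩
    sum (λ j → sum (λ k → x k *E (N k j *E v j)))
      ≡⟨ Σ𝔼.sum-cong-≗ (λ j → Σ𝔼.sum-cong-≗ (λ k → 𝔼.*-assoc (x k) (N k j) (v j))) ⟨
    sum (λ j → sum (λ k → (x k *E N k j) *E v j))
      ≡⟨ Σ𝔼.sum-cong-≗ (λ j → Σ𝔼.*-distribʳ-sum (v j) (λ k → x k *E N k j)) ⟨
    sum (λ j → sum (λ k → x k *E N k j) *E v j) ∎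

combination-⊛ : ∀ {n} (M N C : Matrix n) a b → (∀ i j → C i j ≡ (a *E M i j) +E (b *E N i j)) →
                ∀ v i → (C ⊛ v) i ≡ (a *E (M ⊛ v) i) +E (b *E (N ⊛ v) i)
combination-⊛ M N C a b e v i = trans
  (D𝔼.sum-linear a {h = λ j → b *E (N i j *E v j)}
    (λ j → trans (cong (_*E v j) (e i j)) (rearrange a b (M i j) (N i j) (v j))))
  (cong ((a *E (M ⊛ v) i) +E_) (sym (Σ𝔼.*-distribˡ-sum b (λ j → N i j *E v j))))
  where
  rearrange : ∀ a b m n v → ((a *E m) +E (b *E n)) *E v ≡ (a *E (m *E v)) +E (b *E (n *E v))
  rearrange = Tactic.RingSolver.solve-∀ eisenstein-acr

linProdₗ-toList : ∀ {n} (ls : Vec Eis n) → linProdₗ (Vec.toList ls) ≡ linProd ls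
linProdₗ-toList []       = refl
linProdₗ-toList (l ∷ ls) = cong (linFactor l *ₚ_) (linProdₗ-toList ls)

eigenvalues-annihilate : ∀ {n} (M : Matrix n) (ls : Vec Eis n) → charPoly n M ≈ₚ linProd ls → Annihilates M (Vec.toList ls)
eigenvalues-annihilate M ls e = cayley-hamilton M (Vec.toList ls) (subst (charPoly _ M ≋_) (sym (linProdₗ-toList ls)) (mk e))

real-parts : ∀ {n} (ls : Vec Eis n) → VAll.All (λ c → im c ≡ 0ℤ) ls → Vec.map ℤ→E (Vec.map re ls) ≡ ls
real-parts []               []       = refl
real-parts ((a + b ω) ∷ ls) (p ∷ ps) = cong₂ _∷_ (cong (a +_ω) (sym p)) (real-parts ls ps)

-- The matrices of a Cayley graph

module Cayley {c ℓ} (G : AbelianGroup c ℓ) {n} (E : Enumeration G n)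
  (S : AbelianGroup.Carrier G → Bool) (S-resp : RespectsEq G S) where

  open AbelianGroup G renaming (sym to ≈-sym; trans to ≈-trans) using
    (Carrier; _≈_; _∙_; _⁻¹; ∙-cong; ∙-congˡ; ∙-congʳ; ⁻¹-cong; assoc; comm; setoid)
  open Algebra.Properties.AbelianGroup G
  open Enumeration E

  A H : Matrix n
  A = adjMatrix G E S
  H = hermMatrix₂ G E S

  private
    _⇒_ : Fin n → Fin n → Bool
    _⇒_ = arc G E S

  reflect : Fin n → Fin n → Fin n → Fin n
  reflect u v w = proj₁ (surjective ((elem u ∙ elem v) ∙ elem w ⁻¹))

  elem-reflect : ∀ u v w → elem (reflect u v w) ≈ (elem u ∙ elem v) ∙ elem w ⁻¹
  elem-reflect u v w = proj₂ (surjective ((elem u ∙ elem v) ∙ elem w ⁻¹))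

  x-[x-y]≈y : ∀ x y → x ∙ (x ∙ y ⁻¹) ⁻¹ ≈ y
  x-[x-y]≈y x y = ≈-trans (∙-congˡ (⁻¹-anti-homo‿- x y))
    (≈-trans (≈-sym (assoc x y (x ⁻¹))) (xyx⁻¹≈y x y))

  reflect-involutive : ∀ u v w → reflect u v (reflect u v w) ≡ w
  reflect-involutive u v w = injective _ _ (≈-trans (elem-reflect u v (reflect u v w))
    (≈-trans (∙-congˡ (⁻¹-cong (elem-reflect u v w))) (x-[x-y]≈y (elem u ∙ elem v) (elem w))))

  reflection : Fin n → Fin n → Permutation′ n
  reflection u v = permutation (reflect u v) (reflect u v)
    (reflect-involutive u v) (reflect-involutive u v)

  arc-reflect : ∀ u v w → (u ⇒ reflect u v w) ≡ (w ⇒ v)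
  arc-reflect u v w = S-resp (begin
    elem (reflect u v w) ∙ elem u ⁻¹               ≈⟨ ∙-congʳ (elem-reflect u v w) ⟩
    ((elem u ∙ elem v) ∙ elem w ⁻¹) ∙ elem u ⁻¹    ≈⟨ ∙-congʳ (assoc _ _ _) ⟩
    (elem u ∙ (elem v ∙ elem w ⁻¹)) ∙ elem u ⁻¹    ≈⟨ xyx⁻¹≈y _ _ ⟩
    elem v ∙ elem w ⁻¹                             ∎)
    where open ≈-Reasoning setoid

  reflect-arc : ∀ u v w → (reflect u v w ⇒ u) ≡ (v ⇒ w)
  reflect-arc u v w = S-resp (begin
    elem u ∙ elem (reflect u v w) ⁻¹               ≈⟨ ∙-congˡ (⁻¹-cong (≈-trans (elem-reflect u v w) (assoc _ _ _))) ⟩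
    elem u ∙ (elem u ∙ (elem v ∙ elem w ⁻¹)) ⁻¹    ≈⟨ ∙-congˡ (⁻¹-cong (∙-congˡ (≈-sym (⁻¹-anti-homo‿- _ _)))) ⟩
    elem u ∙ (elem u ∙ (elem w ∙ elem v ⁻¹) ⁻¹) ⁻¹ ≈⟨ x-[x-y]≈y _ _ ⟩
    elem w ∙ elem v ⁻¹                             ∎)
    where open ≈-Reasoning setoid

  reflect-comm : ∀ u v w → reflect u v w ≡ reflect v u w
  reflect-comm u v w = injective _ _ (≈-trans (elem-reflect u v w)
    (≈-trans (∙-congʳ (comm _ _)) (≈-sym (elem-reflect v u w))))

  -- Shared by A and H, so that one normality argument serves both.
  ArcDetermined : Matrix n → Set
  ArcDetermined M = ∀ {u v u′ v′} → (u ⇒ v) ≡ (u′ ⇒ v′) → (v ⇒ u) ≡ (v′ ⇒ u′) → M u v ≡ M u′ v′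

  arcDetermined-reflect : ∀ M → ArcDetermined M → ∀ u v w → M u (reflect u v w) ≡ M w v
  arcDetermined-reflect M det u v w = det (arc-reflect u v w) (reflect-arc u v w)

  arcDetermined⇒commute : ∀ M → ArcDetermined M → Commute (M ⊛_) ((M ᵀ) ⊛_)
  arcDetermined⇒commute M det = normal⇒commute M λ u v → begin
    sum (λ w → M u w *E M v w)
      ≡⟨ Σ𝔼.sum-permute (λ w → M u w *E M v w) (reflection u v) ⟩
    sum (λ w → M u (reflect u v w) *E M v (reflect u v w))
      ≡⟨ Σ𝔼.sum-cong-≗ (λ w → trans
           (cong₂ _*E_ (arcDetermined-reflect M det u v w)
             -- The reflection is symmetric in u and v, so the second factor becomes `M w u`.
             (trans (cong (M v) (reflect-comm u v w)) (arcDetermined-reflect M det v u w)))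
           (𝔼.*-comm (M w v) (M w u))) ⟩
    sum (λ w → M w u *E M w v) ∎
    where open ≡.≡-Reasoning

  A-arcDetermined : ArcDetermined A
  A-arcDetermined {u} {v} {u′} {v′} p q with u ⇒ v | u′ ⇒ v′ | p
  ... | true  | true  | _ = refl
  ... | false | false | _ = refl

  H-arcDetermined : ArcDetermined H
  H-arcDetermined {u} {v} {u′} {v′} p q with u ⇒ v | v ⇒ u | u′ ⇒ v′ | v′ ⇒ u′ | p | q
  ... | true  | true  | true  | true  | _ | _ = refl
  ... | true  | false | true  | false | _ | _ = refl
  ... | false | true  | false | true  | _ | _ = refl
  ... | false | false | false | false | _ | _ = refl

  H-hermitian : Hermitian H
  H-hermitian u v with u ⇒ v | v ⇒ u
  ... | true  | true  = refl
  ... | true  | false = refl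
  ... | false | true  = refl
  ... | false | false = refl

  -ωE : Eis
  -ωE = 0ℤ + Int.-[1+ 0 ] ω

  -- The two one-way weights 1 + ω and -ω add up to 1, the weight of a two-way edge.
  H-from-A : ∀ u v → H u v ≡ ((1ℤ + 1ℤ ω) *E A u v) +E (-ωE *E A v u)
  H-from-A u v with u ⇒ v | v ⇒ u
  ... | true  | true  = refl
  ... | true  | false = refl
  ... | false | true  = refl
  ... | false | false = refl

  πA : Matrix n
  πA u v = π *E A u v

  -- This eliminates the transpose of A: its coefficient is ω² + ω + 1 = 0, while that of A is -ω(1
  -- + ω) - ω = 1 - ω.
  πA-from-H : ∀ u v → πA u v ≡ (-ωE *E H u v) +E (1E *E H v u)
  πA-from-H u v with u ⇒ v | v ⇒ u
  ... | true  | true  = refl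
  ... | true  | false = refl
  ... | false | true  = refl
  ... | false | false = refl

  πA⊛ : ∀ v i → (πA ⊛ v) i ≡ π *E (A ⊛ v) i
  πA⊛ v i = trans (Σ𝔼.sum-cong-≗ (λ j → 𝔼.*-assoc π (A i j) (v j)))
    (sym (Σ𝔼.*-distribˡ-sum π (λ j → A i j *E v j)))

  eisenstein⇒hs : EisensteinIntegral G E S → HSIntegral G E S
  eisenstein⇒hs (ls , e) = Vec.map re roots ,
      subst (λ rs → charPoly n H ≈ₚ linProd rs) (sym (real-parts roots (proj₁ (proj₂ split)))) (coeffs (proj₂ (proj₂ split)))
    where
    annA : Annihilates A (Vec.toList ls)
    annA = eigenvalues-annihilate A ls e
    candidates = combinedRoots (1ℤ + 1ℤ ω) -ωE (Vec.toList ls) (Vec.toList ls)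
    annH : Annihilates H candidates
    annH = annihilates-combination A (A ᵀ) H (1ℤ + 1ℤ ω) -ωE (arcDetermined⇒commute A A-arcDetermined)
      (combination-⊛ A (A ᵀ) H (1ℤ + 1ℤ ω) -ωE H-from-A) (Vec.toList ls) (Vec.toList ls) annA (annihilates-transpose A (Vec.toList ls) annA)
    real = discard-injective H (hermitian-eigenvalue H H-hermitian) candidates
    split = annihilated⇒splits H (proj₁ real) (proj₁ (proj₂ real)) (λ v → proj₂ (proj₂ real) v (annH v))
    roots = proj₁ split

  hs⇒eisenstein : HSIntegral G E S → EisensteinIntegral G E S
  hs⇒eisenstein (ls , e) = proj₁ split , coeffs (proj₂ (proj₂ split))
    where
    xs = Vec.toList (Vec.map ℤ→E ls)
    annH : Annihilates H xs
    annH = eigenvalues-annihilate H (Vec.map ℤ→E ls) e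
    candidates = combinedRoots -ωE 1E xs xs
    annπA : Annihilates πA candidates
    annπA = annihilates-combination H (H ᵀ) πA -ωE 1E (arcDetermined⇒commute H H-arcDetermined)
      (combination-⊛ H (H ᵀ) πA -ωE 1E πA-from-H) xs xs annH (annihilates-transpose H xs annH)
    divisible = discard-injective πA (π-multiple-eigenvalue A πA πA⊛) candidates
    divided = divide-roots-by-π A πA πA⊛ (proj₁ (proj₂ divisible))
    -- Any roots in ℤ[ω] will do here, so the predicate carried along is trivial.
    split = annihilated⇒splits {P = λ _ → ⊤} A (proj₁ divided) (All.universal (λ _ → tt) (proj₁ divided))
      (λ v → proj₂ divided v (proj₂ (proj₂ divisible) v (annπA v)))

theorem5p9 : {c ℓ : Level} (G : AbelianGroup c ℓ) (n : ℕ) (E : Enumeration G n)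
    (S : AbelianGroup.Carrier G → Bool) → RespectsEq G S →
    S (AbelianGroup.ε G) ≡ false →
    EisensteinIntegral G E S ⇔ HSIntegral G E S
theorem5p9 G n E S S-resp _ = mk⇔ eisenstein⇒hs hs⇒eisenstein
  where open Cayley G E S S-resp
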